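{- Let $r \ge 2$ and $k>r+2$ be integers. Then for every positive integer $n$, $T_r(n,k-1)$ has the maximum number of hyperedges among all $n$-vertex Berge-$K_k$-free $r$-uniform hypergraphs.
   Context: All graphs and hypergraphs are finite and simple. $T_r(n,m)$ denotes the complete $m$-partite $n$-vertex $r$-uniform hypergraph in which all parts have size $\lfloor n/m\rfloor$ or $\lceil n/m\rceil$ (its hyperedges are all $r$-sets of vertices meeting each part in at most one vertex). A hypergraph $\mathcal{H}$ contains a Berge-$F$ (Berge copy of the graph $F$) if there are an injection $\varphi:V(F)\to V(\mathcal{H})$ and an injection $f:E(F)\to E(\mathcal{H})$ with $\{\varphi(u),\varphi(v)\}\subset f(uv)$ for every edge $uv\in E(F)$; otherwise it is Berge-$F$-free. -}

module Defs where

open import Data.Bool.Base using (Bool; false)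
open import Data.Fin.Base using (Fin; zero; suc; splitAt; inject≤; _↑ˡ_; _↑ʳ_)
open import Data.Fin.Properties using (_≟_; all?; nonZeroIndex; splitAt-↑ˡ; splitAt-↑ʳ)
open import Data.Fin.Subset using (Subset; inside; outside; ∣_∣; _∩_; _∈_)
open import Data.List.Base using (List; []; _∷_; [_]; map; _++_; filter; length; lookup)
open import Data.List.Membership.Propositional using () renaming (_∈_ to _∈ˡ_)
open import Data.List.Membership.Propositional.Properties
  using (∈-map⁺; ∈-map⁻; ∈-++⁺ˡ; ∈-++⁺ʳ; ∈-filter⁺; ∈-filter⁻)
open import Data.List.Relation.Unary.All as All using (All; [])
open import Data.List.Relation.Unary.All.Properties using (all-filter)
open import Data.List.Relation.Unary.AllPairs using ([]; _∷_)
open import Data.List.Relation.Unary.Any using (here)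
open import Data.List.Relation.Unary.Unique.Propositional using (Unique)
import Data.List.Relation.Unary.Unique.Propositional.Properties as Unique
open import Data.Nat.Base
open import Data.Nat.Divisibility using (n∣m*n)
open import Data.Nat.DivMod
import Data.Nat.Properties as ℕ
open import Data.Product.Base using (Σ; ∃; _×_; _,_; proj₁; proj₂)
open import Data.Sum.Base using (_⊎_; inj₁; inj₂; [_,_]′)
open import Data.Vec.Base as Vec using ([]; _∷_)
import Data.Vec.Properties as Vec
open import Function.Base using (id; _∘_)
open import Function.Bundles using (_⇔_; mk⇔)
open import Function.Definitions using (Injective)
open import Relation.Binary.PropositionalEquality
  using (_≡_; refl; sym; trans; cong; cong₂; subst; module ≡-Reasoning)
open import Relation.Nullary using (¬_; does)
open import Relation.Nullary.Decidable using (_×-dec_)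
open import Relation.Unary using (Decidable)

private
  variable
    n m r v : ℕ

record Hypergraph (n r : ℕ) : Set where
  field
    edges   : List (Subset n)
    unique  : Unique edges
    uniform : All (λ e → ∣ e ∣ ≡ r) edges

  size : ℕ
  size = length edges

  edge : Fin size → Subset n
  edge = lookup edges

open Hypergraph public

Graph : ℕ → Set
Graph v = Hypergraph v 2

-- Since edge lists are duplicate-free, Fin (size H) stands for the edge set of H.
record BergeCopy (F : Graph v) (H : Hypergraph n r) : Set where
  field
    φ           : Fin v → Fin n
    φ-injective : Injective _≡_ _≡_ φ
    f           : Fin (size F) → Fin (size H)
    f-injective : Injective _≡_ _≡_ f
    contains    : ∀ i u → u ∈ edge F i → φ u ∈ edge H (f i)

BergeFree : Graph v → Hypergraph n r → Set
BergeFree F H = ¬ BergeCopy F H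

IsMaximumBergeFree : Graph v → Hypergraph n r → Set
IsMaximumBergeFree {n = n} {r = r} F T =
  BergeFree F T × (∀ (H : Hypergraph n r) → BergeFree F H → size H ≤ size T)

subsets : ∀ n → List (Subset n)
subsets zero    = [ [] ]
subsets (suc n) = map (inside ∷_) (subsets n) ++ map (outside ∷_) (subsets n)

∈-subsets : ∀ (e : Subset n) → e ∈ˡ subsets n
∈-subsets []            = here refl
∈-subsets (inside  ∷ e) = ∈-++⁺ˡ (∈-map⁺ _ (∈-subsets e))
∈-subsets (outside ∷ e) = ∈-++⁺ʳ _ (∈-map⁺ _ (∈-subsets e))

subsets-unique : ∀ n → Unique (subsets n)
subsets-unique zero    = [] ∷ []
subsets-unique (suc n) = Unique.++⁺
  (Unique.map⁺ Vec.∷-injectiveʳ (subsets-unique n))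
  (Unique.map⁺ Vec.∷-injectiveʳ (subsets-unique n))
  disjoint
  where
  disjoint : ∀ {e} → ¬ (e ∈ˡ map (inside ∷_) (subsets n) × e ∈ˡ map (outside ∷_) (subsets n))
  disjoint (p , q) with ∈-map⁻ _ p | ∈-map⁻ _ q
  ... | _ , _ , refl | _ , _ , ()

complete : ∀ n r → Hypergraph n r
complete n r = record
  { edges   = filter (λ e → ∣ e ∣ ℕ.≟ r) (subsets n)
  ; unique  = Unique.filter⁺ _ (subsets-unique n)
  ; uniform = all-filter _ (subsets n)
  }

K : ∀ k → Graph k
K k = complete k 2

part : (Fin n → Fin m) → Fin m → Subset n
part π j = Vec.tabulate (λ u → does (π u ≟ j))

⌈_/_⌉ : ∀ n m .{{_ : NonZero m}} → ℕ
⌈ n / m ⌉ = (n + (m ∸ 1)) / m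

-- nonZeroIndex j : NonZero m supplies the divisor condition; parts may be empty.
Balanced : (Fin n → Fin m) → Set
Balanced {n} {m} π = ∀ (j : Fin m) → let instance _ = nonZeroIndex j in
  ∣ part π j ∣ ≡ n / m ⊎ ∣ part π j ∣ ≡ ⌈ n / m ⌉

Transversal : (Fin n → Fin m) → Subset n → Set
Transversal π e = ∀ j → ∣ e ∩ part π j ∣ ≤ 1

-- T is a copy of T_r(n,m).
IsTurán : ∀ m → Hypergraph n r → Set
IsTurán {n} {r} m T = ∃ λ (π : Fin n → Fin m) → Balanced π ×
  (∀ (e : Subset n) → e ∈ˡ edges T ⇔ (∣ e ∣ ≡ r × Transversal π e))

admissible? : ∀ r (π : Fin n → Fin m) → Decidable (λ e → ∣ e ∣ ≡ r × Transversal π e)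
admissible? r π e = (∣ e ∣ ℕ.≟ r) ×-dec all? (λ j → ∣ e ∩ part π j ∣ ℕ.≤? 1)

completePartite : ∀ r → (Fin n → Fin m) → Hypergraph n r
completePartite {n} r π = record
  { edges   = filter (admissible? r π) (subsets n)
  ; unique  = Unique.filter⁺ (admissible? r π) (subsets-unique n)
  ; uniform = All.map proj₁ (all-filter (admissible? r π) (subsets n))
  }

completePartite-turán : ∀ r (π : Fin n → Fin m) → Balanced π → IsTurán m (completePartite r π)
completePartite-turán {n} r π bal = π , bal , λ e → mk⇔
  (λ e∈ → proj₂ (∈-filter⁻ (admissible? r π) {xs = subsets n} e∈))
  (∈-filter⁺ (admissible? r π) (∈-subsets e))

-- A balanced partition: q full rounds through the m parts, then s ≤ m further vertices.
private
  rounds : (q m s : ℕ) → ℕ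
  rounds zero    m s = s
  rounds (suc q) m s = m + rounds q m s

  assign : ∀ q {m s} → s ≤ m → Fin (rounds q m s) → Fin m
  assign zero    s≤m u = inject≤ u s≤m
  assign (suc q) s≤m u = [ id , assign q s≤m ]′ (splitAt _ u)

  rounds≡ : ∀ q m s → rounds q m s ≡ s + q * m
  rounds≡ zero    m s = sym (ℕ.+-identityʳ s)
  rounds≡ (suc q) m s = begin
    m + rounds q m s  ≡⟨ cong (m +_) (rounds≡ q m s) ⟩
    m + (s + q * m)   ≡⟨ ℕ.+-assoc m s _ ⟨
    m + s + q * m     ≡⟨ cong (_+ q * m) (ℕ.+-comm m s) ⟩
    s + m + q * m     ≡⟨ ℕ.+-assoc s m _ ⟩
    s + (m + q * m)   ∎
    where open ≡-Reasoning

  ∣tabulate-+∣ : ∀ a {b} (g : Fin (a + b) → Bool) →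
    ∣ Vec.tabulate g ∣ ≡ ∣ Vec.tabulate (g ∘ (_↑ˡ b)) ∣ + ∣ Vec.tabulate (g ∘ (a ↑ʳ_)) ∣
  ∣tabulate-+∣ zero    g = refl
  ∣tabulate-+∣ (suc a) g with g zero
  ... | inside  = cong suc (∣tabulate-+∣ a (g ∘ suc))
  ... | outside = ∣tabulate-+∣ a (g ∘ suc)

  ∣tabulate-false∣ : ∀ n → ∣ Vec.tabulate {n = n} (λ _ → false) ∣ ≡ 0
  ∣tabulate-false∣ zero    = refl
  ∣tabulate-false∣ (suc n) = ∣tabulate-false∣ n

  ∣part-id∣ : ∀ (j : Fin m) → ∣ part id j ∣ ≡ 1
  ∣part-id∣ {suc m} zero    = cong suc (∣tabulate-false∣ m)
  ∣part-id∣ {suc m} (suc j) = ∣part-id∣ j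

  ∣part-inject≤∣ : ∀ {s} (s≤m : s ≤ m) (j : Fin m) →
    ∣ part (λ u → inject≤ u s≤m) j ∣ ≡ 0 ⊎ (∣ part (λ u → inject≤ u s≤m) j ∣ ≡ 1 × 0 < s)
  ∣part-inject≤∣ {s = zero}  _         _       = inj₁ refl
  ∣part-inject≤∣ {s = suc s} (s≤s s≤m) zero    = inj₂ (cong suc (∣tabulate-false∣ s) , z<s)
  ∣part-inject≤∣ {s = suc s} (s≤s s≤m) (suc j) with ∣part-inject≤∣ s≤m j
  ... | inj₁ eq       = inj₁ eq
  ... | inj₂ (eq , _) = inj₂ (eq , z<s)

  ∣part-assign∣ : ∀ q {m s} (s≤m : s ≤ m) (j : Fin m) →
    ∣ part (assign q s≤m) j ∣ ≡ q + ∣ part (assign 0 s≤m) j ∣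
  ∣part-assign∣ zero    s≤m j = refl
  ∣part-assign∣ (suc q) {m} {s} s≤m j = begin
    ∣ part (assign (suc q) s≤m) j ∣
      ≡⟨ ∣tabulate-+∣ m (λ u → does (assign (suc q) s≤m u ≟ j)) ⟩
    _ ≡⟨ cong₂ _+_
          (cong ∣_∣ (Vec.tabulate-cong λ u → cong (λ x → does ([ id , assign q s≤m ]′ x ≟ j))
            (splitAt-↑ˡ m u (rounds q m s))))
          (cong ∣_∣ (Vec.tabulate-cong λ u → cong (λ x → does ([ id , assign q s≤m ]′ x ≟ j))
            (splitAt-↑ʳ m (rounds q m s) u))) ⟩
    ∣ part id j ∣ + ∣ part (assign q s≤m) j ∣
      ≡⟨ cong₂ _+_ (∣part-id∣ j) (∣part-assign∣ q s≤m j) ⟩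
    suc q + ∣ part (assign 0 s≤m) j ∣ ∎
    where open ≡-Reasoning

  /-rounds : ∀ q m s .{{_ : NonZero m}} → s < m → (s + q * m) / m ≡ q
  /-rounds q m s s<m = begin
    (s + q * m) / m      ≡⟨ +-distrib-/-∣ʳ s (n∣m*n q) ⟩
    s / m + q * m / m    ≡⟨ cong₂ _+_ (m<n⇒m/n≡0 s<m) (m*n/n≡m q m) ⟩
    q                    ∎
    where open ≡-Reasoning

  ⌈/⌉-rounds : ∀ q m s .{{_ : NonZero m}} → 0 < s → s < m → ⌈ s + q * m / m ⌉ ≡ suc q
  ⌈/⌉-rounds q (suc m) (suc s) _ s<m = begin
    (suc s + q * suc m + m) / suc m    ≡⟨ cong (_/ suc m) shuffle ⟩
    (s + suc q * suc m) / suc m        ≡⟨ /-rounds (suc q) (suc m) s (ℕ.<-trans (ℕ.n<1+n s) s<m) ⟩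
    suc q                              ∎
    where
    open ≡-Reasoning
    shuffle : suc s + q * suc m + m ≡ s + suc q * suc m
    shuffle = begin
      suc (s + q * suc m + m)    ≡⟨ ℕ.+-suc _ m ⟨
      s + q * suc m + suc m      ≡⟨ ℕ.+-assoc s _ _ ⟩
      s + (q * suc m + suc m)    ≡⟨ cong (s +_) (ℕ.+-comm _ (suc m)) ⟩
      s + suc q * suc m          ∎

  assign-balanced : ∀ q {m s} (s<m : s < m) → Balanced (assign q (ℕ.<⇒≤ s<m))
  assign-balanced q {m} {s} s<m j rewrite ∣part-assign∣ q (ℕ.<⇒≤ s<m) j
    with ∣part-inject≤∣ (ℕ.<⇒≤ s<m) j
  ... | inj₁ eq rewrite eq =
    inj₁ (trans (ℕ.+-identityʳ q)
      (sym (trans (cong (_/ m) (rounds≡ q m s)) (/-rounds q m s s<m))))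
    where instance _ = nonZeroIndex j
  ... | inj₂ (eq , 0<s) rewrite eq =
    inj₂ (trans (ℕ.+-comm q 1)
      (sym (trans (cong ⌈_/ m ⌉ (rounds≡ q m s)) (⌈/⌉-rounds q m s 0<s s<m))))
    where instance _ = nonZeroIndex j

balanced-exists : ∀ n m .{{_ : NonZero m}} → Σ (Fin n → Fin m) Balanced
balanced-exists n m = subst (λ x → Σ (Fin x → Fin m) Balanced)
  (trans (rounds≡ (n / m) m (n % m)) (sym (m≡m%n+[m/n]*n n m)))
  (assign (n / m) (ℕ.<⇒≤ (m%n<n n m)) , assign-balanced (n / m) (m%n<n n m))

turán-exists : ∀ r n m .{{_ : NonZero m}} → ∃ λ (T : Hypergraph n r) → IsTurán m T
turán-exists r n m =
  let π , bal = balanced-exists n m in completePartite r π , completePartite-turán r π bal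

{-# OPTIONS --safe #-}

-- By König's theorem for the incidences between hyperedges and pairs of vertices, a
-- Berge-K_k-free hypergraph has at most #(blue edges) + #(red r-cliques) hyperedges for
-- some edge-disjoint blue and red graphs whose union is K_k-free: the edges of the union
-- are matched to distinct hyperedges, so that a K_k in it is a Berge copy of K_k.
--
-- Put m = k − 1 and let A be an m-set of vertices containing a maximum clique of the union.
-- An s-clique outside A has at most m − s common neighbours in A, so by counting according
-- to the trace outside A there are at most Σ_s C(m − s, r − s) c_s cliques of size r, where
-- c_s is the number of s-cliques outside A; if r ≤ m − 2, then this also bounds blue edges
-- plus red r-cliques. In the Turán graph, equality holds when A is a transversal, and what
-- remains is again a Turán graph. Induction on the size of the parts thus gives Zykov's
-- theorem c_s ≤ c_s(Turán graph), and one more step gives the coloured bound.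
module Submission where

open import Defs
open import Data.Bool.Base using (Bool; true; false; T; not; _∨_)
import Data.Bool.Properties as Bool
open import Data.Bool.Properties using (T?; T-∨)
open import Data.Fin.Base using (Fin; zero; suc)
import Data.Fin.Properties as Fin
open import Data.Fin.Subset using (Subset; inside; outside; ∣_∣; _∩_; _∪_; ⁅_⁆)
  renaming (_∈_ to _∈ˢ_; _⊆_ to _⊆ˢ_)
open import Data.Fin.Subset.Properties
  using (⊆-antisym; x∈⁅x⁆; x∈⁅y⁆⇒x≡y; x∈p∪q⁺; x∈p∪q⁻; x∈p∩q⁺; x∈p∩q⁻; ∪-comm; ∪-identityˡ; ∪-identityʳ;
    ∣⁅x⁆∣≡1; p⊆q⇒∣p∣≤∣q∣; p⊂q⇒∣p∣<∣q∣; ∣p∩q∣≤∣q∣)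
  renaming (_∈?_ to _∈ˢ?_; _⊆?_ to _⊆ˢ?_)
open import Data.List.Base as List
  using (List; []; _∷_; [_]; map; _++_; length; lookup; filter; filterᵇ; tabulate; take; drop; allFin)
open import Data.List.Membership.Propositional using (_∈_)
import Data.List.Membership.DecPropositional as DecMembership
open import Data.List.Membership.Propositional.Properties
  using (∈-map⁺; ∈-map⁻; ∈-++⁺ˡ; ∈-++⁺ʳ; ∈-++⁻; ∈-filter⁺; ∈-filter⁻; ∈-∃++; ∈-allFin; ∈-lookup;
    ∈-map∷⁻; ∈-AllPairs₂)
open import Data.List.Properties
  using (length-filter; filter-++; filter-all; filter-none; filter-some; filter-accept; filter-reject;
    length-++; length-map; length-take; length-tabulate; map-++; map-tabulate; ++-assoc; ++-identityʳ;
    take++drop≡id; ∷-injectiveʳ)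
open import Data.List.Relation.Binary.Permutation.Propositional
  using (_↭_; refl; prep; swap; ↭-sym; ↭-trans; ↭-reflexive; ↭⇒↭ₛ; module PermutationReasoning)
open import Data.List.Relation.Binary.Permutation.Propositional.Properties
  using (filter-↭; ++-comm; shift; ↭-length; All-resp-↭; ∈-resp-↭)
  renaming (map⁺ to ↭-map⁺; ++⁺ˡ to ↭-++⁺ˡ)
open import Data.List.Relation.Binary.Permutation.Setoid.Properties using (Unique-resp-↭)
open import Data.List.Relation.Binary.Sublist.Heterogeneous.Properties using (⊆-filter-Sublist)
open import Data.List.Relation.Binary.Sublist.Propositional
  using (_⊆_; []; _∷_; _∷ʳ_; ⊆-refl; ⊆-trans; minimum)
open import Data.List.Relation.Binary.Sublist.Propositional.Properties
  using (filter-⊆; All-resp-⊆; Any-resp-⊆)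
  renaming (map⁺ to ⊆-map⁺; ++⁺ˡ to ++⁺ˡ-⊆; ++⁺ʳ to ++⁺ʳ-⊆)
open import Data.List.Relation.Unary.All as All using (All; []; _∷_)
open import Data.List.Relation.Unary.All.Properties using (all-filter; ++⁻ˡ; ++⁻ʳ; ¬Any⇒All¬)
  renaming (map⁺ to All-map⁺; map⁻ to All-map⁻; ++⁺ to All-++⁺)
open import Data.List.Relation.Unary.AllPairs as AllPairs using (AllPairs; []; _∷_)
open import Data.List.Relation.Unary.AllPairs.Properties using ()
  renaming (filter⁺ to AllPairs-filter⁺; map⁻ to AllPairs-map⁻)
open import Data.List.Relation.Unary.Any as Any using (here; there)
open import Data.List.Relation.Unary.Any.Properties using (lookup-index)
open import Data.List.Relation.Unary.Unique.Propositional using (Unique)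
import Data.List.Relation.Unary.Unique.Propositional.Properties as Unique
open import Data.List.Relation.Unary.Unique.Propositional.Properties using (Unique[x∷xs]⇒x∉xs)
open import Data.Nat.Base
open import Data.Nat.Combinatorics
  using (_C_; nC1≡n; nCn≡1; nCk≡nC[n∸k]; nCk+nC[k+1]≡[n+1]C[k+1]; k>n⇒nCk≡0)
open import Data.Nat.Divisibility using (∣-refl)
open import Data.Nat.DivMod using (_/_; /-monoˡ-≤; n/n≡1; +-distrib-/-∣ʳ)
open import Data.Nat.Properties
open import Data.Nat.Tactic.RingSolver using (solve-∀)
open import Data.Product.Base using (∃; ∃₂; _×_; _,_; proj₁; proj₂)
open import Data.Sum.Base using (_⊎_; inj₁; inj₂; [_,_]′)
open import Data.Vec.Base as Vec using ([]; _∷_; here; there)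
open import Data.Vec.Properties using (≡-dec; lookup∘tabulate; lookup⇒[]=; []=⇒lookup)
open import Function.Base using (_∘_; id)
open import Function.Bundles using (Equivalence)
open import Relation.Binary.Definitions using (DecidableEquality)
open import Relation.Binary.PropositionalEquality
  using (_≡_; _≢_; refl; sym; trans; cong; cong₂; subst; setoid; module ≡-Reasoning)
open import Relation.Nullary using (¬_; Dec; contradiction; does; yes; no; ¬?)
open import Relation.Nullary.Decidable using (_×-dec_; dec-true; decidable-stable)

private
  variable
    X : Set

-- Binomial coefficients

nC0≡1 : ∀ n → n C 0 ≡ 1
nC0≡1 n = trans (nCk≡nC[n∸k] {0} {n} z≤n) (nCn≡1 n)

C-≤-suc : ∀ n k → n C k ≤ suc n C k
C-≤-suc n zero    = ≤-reflexive (trans (nC0≡1 n) (sym (nC0≡1 (suc n))))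
C-≤-suc n (suc k) = subst (n C suc k ≤_) (nCk+nC[k+1]≡[n+1]C[k+1] n k) (m≤n+m _ (n C k))

C-monoˡ-≤′ : ∀ {m n} k → m ≤′ n → m C k ≤ n C k
C-monoˡ-≤′ k ≤′-refl     = ≤-refl
C-monoˡ-≤′ k (≤′-step p) = ≤-trans (C-monoˡ-≤′ k p) (C-≤-suc _ k)

C-monoˡ-≤ : ∀ {m n} k → m ≤ n → m C k ≤ n C k
C-monoˡ-≤ k m≤n = C-monoˡ-≤′ k (≤⇒≤′ m≤n)

C>0 : ∀ {n k} → k ≤ n → 0 < n C k
C>0 {n} {k} k≤n = ≤-trans (≤-reflexive (sym (nCn≡1 k))) (C-monoˡ-≤ k k≤n)

-- In Pascal's rule the first summand is at least `n` by induction and the second is positive,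
-- because the bound on `k` is strict.
n≤nC[1+k] : ∀ {n k} → suc k < n → n ≤ n C suc k
n≤nC[1+k] {suc n} {zero}  _     = ≤-reflexive (sym (nC1≡n (suc n)))
n≤nC[1+k] {suc n} {suc k} (s≤s 1+k<n) = subst (suc n ≤_) (nCk+nC[k+1]≡[n+1]C[k+1] n (suc k))
  (≤-trans (≤-reflexive (+-comm 1 n)) (+-mono-≤ (n≤nC[1+k] 1+k<n) (C>0 1+k<n)))

-- If k ≤ c, then adding an element to a c-set creates a (1+k)-subset.
b+C≤C : ∀ b c {n k} → b + c ≤ n → suc k < n → b + c C suc k ≤ n C suc k
b+C≤C zero    c {k = k} c≤n _ = C-monoˡ-≤ (suc k) c≤n
b+C≤C (suc b) c {n} {k} b+c<n k<n with k ≤? c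
... | yes k≤c = begin
  suc b + c C suc k            ≡⟨ +-suc b _ ⟨
  b + suc (c C suc k)          ≤⟨ +-monoʳ-≤ b (+-monoˡ-≤ (c C suc k) (C>0 k≤c)) ⟩
  b + (c C k + c C suc k)      ≡⟨ cong (b +_) (nCk+nC[k+1]≡[n+1]C[k+1] c k) ⟩
  b + suc c C suc k            ≤⟨ b+C≤C b (suc c) (≤-trans (≤-reflexive (+-suc b c)) b+c<n) k<n ⟩
  n C suc k                    ∎
  where open ≤-Reasoning
-- Here `c < k`, so a `c`-set has no (1+k)-subset and only `suc b ≤ n` has to be bounded.
... | no k≰c = begin
  suc b + c C suc k            ≡⟨ cong (suc b +_) (k>n⇒nCk≡0 (m≤n⇒m≤1+n (≰⇒> k≰c))) ⟩
  suc b + 0                    ≡⟨ +-identityʳ (suc b) ⟩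
  suc b                        ≤⟨ ≤-trans (m≤m+n (suc b) c) b+c<n ⟩
  n                            ≤⟨ n≤nC[1+k] k<n ⟩
  n C suc k                    ∎
  where open ≤-Reasoning

-- Counting cliques

exchange₃ : ∀ i j k → i + (j + k) ≡ j + (i + k)
exchange₃ = solve-∀

exchange₄ : ∀ i j k l → (i + j) + (k + l) ≡ (i + k) + (j + l)
exchange₄ = solve-∀

Adjacency : Set → Set
Adjacency X = X → X → Bool

-- Each clique is counted at its member that comes first in the list, so adjacency is consulted only
-- from earlier to later entries.
cliqueCount : Adjacency X → ℕ → List X → ℕ
cliqueCount a zero    xs       = 1
cliqueCount a (suc r) []       = 0
cliqueCount a (suc r) (x ∷ xs) = cliqueCount a r (filterᵇ (a x) xs) + cliqueCount a (suc r) xs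

filterᵇ-⊆ : ∀ {p q : X → Bool} → (∀ {x} → T (p x) → T (q x)) →
  ∀ {xs ys} → xs ⊆ ys → filterᵇ p xs ⊆ filterᵇ q ys
filterᵇ-⊆ {p = p} {q} p⇒q = ⊆-filter-Sublist (T? ∘ p) (T? ∘ q) (λ { refl → p⇒q })

cliqueCount-mono : ∀ {a b : Adjacency X} → (∀ {x y} → T (a x y) → T (b x y)) →
  ∀ r {xs ys} → xs ⊆ ys → cliqueCount a r xs ≤ cliqueCount b r ys
cliqueCount-mono a⇒b zero    _  = ≤-refl
cliqueCount-mono a⇒b (suc r) [] = z≤n
cliqueCount-mono a⇒b (suc r) (y ∷ʳ s) = m≤n⇒m≤o+n _ (cliqueCount-mono a⇒b (suc r) s)
cliqueCount-mono a⇒b (suc r) (refl ∷ s) =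
  +-mono-≤ (cliqueCount-mono a⇒b r (filterᵇ-⊆ a⇒b s)) (cliqueCount-mono a⇒b (suc r) s)

filterᵇ-comm : ∀ (p q : X → Bool) xs → filterᵇ p (filterᵇ q xs) ≡ filterᵇ q (filterᵇ p xs)
filterᵇ-comm p q [] = refl
filterᵇ-comm p q (x ∷ xs) with p x in eqp | q x in eqq
... | true  | true  rewrite eqp | eqq = cong (x ∷_) (filterᵇ-comm p q xs)
... | true  | false rewrite eqq = filterᵇ-comm p q xs
... | false | true  rewrite eqp = filterᵇ-comm p q xs
... | false | false = filterᵇ-comm p q xs

-- Cliques are sorted by whether they contain both `x` and `y`, just one of them, or neither. Those
-- with both come from the common link, where the two filters commute.
cliqueCount-swap : ∀ {a : Adjacency X} → (∀ x y → a x y ≡ a y x) →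
  ∀ r x y xs → cliqueCount a (suc r) (x ∷ y ∷ xs) ≡ cliqueCount a (suc r) (y ∷ x ∷ xs)
cliqueCount-swap {a = a} a-sym r x y xs rewrite a-sym y x with a x y
... | false = exchange₃ (cliqueCount a r (filterᵇ (a x) xs)) (cliqueCount a r (filterᵇ (a y) xs)) _
... | true with r
...   | zero  = refl
...   | suc s rewrite filterᵇ-comm (a y) (a x) xs =
  exchange₄ (cliqueCount a s (filterᵇ (a x) (filterᵇ (a y) xs))) (cliqueCount a (suc s) (filterᵇ (a x) xs)) _ _

cliqueCount-↭ : ∀ {a : Adjacency X} → (∀ x y → a x y ≡ a y x) →
  ∀ r {xs ys} → xs ↭ ys → cliqueCount a r xs ≡ cliqueCount a r ys
cliqueCount-↭ a-sym zero    _    = refl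
cliqueCount-↭ a-sym (suc r) refl = refl
cliqueCount-↭ {a = a} a-sym (suc r) (prep x p) =
  cong₂ _+_ (cliqueCount-↭ a-sym r (filter-↭ (T? ∘ a x) p)) (cliqueCount-↭ a-sym (suc r) p)
cliqueCount-↭ {a = a} a-sym (suc r) (swap {xs} x y p) =
  trans (cliqueCount-swap a-sym r x y xs)
    (cong₂ _+_ (cliqueCount-↭ a-sym r (filter-↭ (T? ∘ a y) (prep x p)))
      (cong₂ _+_ (cliqueCount-↭ a-sym r (filter-↭ (T? ∘ a x) p)) (cliqueCount-↭ a-sym (suc r) p)))
cliqueCount-↭ a-sym (suc r) (_↭_.trans p q) =
  trans (cliqueCount-↭ a-sym (suc r) p) (cliqueCount-↭ a-sym (suc r) q)

cliqueCount-1 : ∀ (a : Adjacency X) xs → cliqueCount a 1 xs ≡ length xs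
cliqueCount-1 a []       = refl
cliqueCount-1 a (x ∷ xs) = cong suc (cliqueCount-1 a xs)

cliqueCount≤C : ∀ (a : Adjacency X) r xs → cliqueCount a r xs ≤ length xs C r
cliqueCount≤C a zero    xs       = C>0 {length xs} z≤n
cliqueCount≤C a (suc r) []       = z≤n
cliqueCount≤C a (suc r) (x ∷ xs) = begin
  cliqueCount a r ys + cliqueCount a (suc r) xs
    ≤⟨ +-mono-≤ (cliqueCount≤C a r ys) (cliqueCount≤C a (suc r) xs) ⟩
  length ys C r + length xs C suc r
    ≤⟨ +-monoˡ-≤ _ (C-monoˡ-≤ r (length-filter (T? ∘ a x) xs)) ⟩
  length xs C r + length xs C suc r
    ≡⟨ nCk+nC[k+1]≡[n+1]C[k+1] (length xs) r ⟩
  suc (length xs) C suc r ∎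
  where
  open ≤-Reasoning
  ys = filterᵇ (a x) xs

cliqueCount≥C : ∀ {a : Adjacency X} {xs} r → AllPairs (λ x y → T (a x y)) xs →
  length xs C r ≤ cliqueCount a r xs
cliqueCount≥C {xs = xs} zero    _  = ≤-reflexive (nC0≡1 (length xs))
cliqueCount≥C           (suc r) [] = z≤n
cliqueCount≥C {a = a} {x ∷ xs} (suc r) (px ∷ pxs) = begin
  suc (length xs) C suc r            ≡⟨ nCk+nC[k+1]≡[n+1]C[k+1] (length xs) r ⟨
  length xs C r + length xs C suc r  ≤⟨ +-mono-≤ (cliqueCount≥C r pxs) (cliqueCount≥C (suc r) pxs) ⟩
  cliqueCount a r xs + cliqueCount a (suc r) xs
    ≡⟨ cong (λ ys → cliqueCount a r ys + cliqueCount a (suc r) xs) (filter-all (T? ∘ a x) px) ⟨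
  cliqueCount a (suc r) (x ∷ xs)     ∎
  where open ≤-Reasoning

-- peel r m c = Σ_{s ≤ r} C(m − s, r − s) · c s. If every s-clique outside an m-set A has
-- at most m − s common neighbours in A, then this bounds the number of r-cliques, where
-- c s is the number of s-cliques outside A.
peel : ℕ → ℕ → (ℕ → ℕ) → ℕ
peel zero    m c = c 0
peel (suc r) m c = (m C suc r) * c 0 + peel r (pred m) (c ∘ suc)

peel-mono : ∀ r m {c d : ℕ → ℕ} → (∀ s → c s ≤ d s) → peel r m c ≤ peel r m d
peel-mono zero    m c≤d = c≤d 0
peel-mono (suc r) m c≤d =
  +-mono-≤ (*-monoʳ-≤ (m C suc r) (c≤d 0)) (peel-mono r (pred m) (c≤d ∘ suc))

peel-+ : ∀ r m (c d : ℕ → ℕ) → peel r m (λ s → c s + d s) ≡ peel r m c + peel r m d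
peel-+ zero    m c d = refl
peel-+ (suc r) m c d = begin
  k * (c 0 + d 0) + peel r (pred m) (λ s → c (suc s) + d (suc s))
    ≡⟨ cong (k * (c 0 + d 0) +_) (peel-+ r (pred m) (c ∘ suc) (d ∘ suc)) ⟩
  k * (c 0 + d 0) + (peel r (pred m) (c ∘ suc) + peel r (pred m) (d ∘ suc))
    ≡⟨ distrib k (c 0) (d 0) _ _ ⟩
  peel (suc r) m c + peel (suc r) m d ∎
  where
  open ≡-Reasoning
  k = m C suc r
  distrib : ∀ k i j p q → k * (i + j) + (p + q) ≡ (k * i + p) + (k * j + q)
  distrib = solve-∀

peel-zero : ∀ r m → peel r m (λ _ → 0) ≡ 0
peel-zero zero    m = refl
peel-zero (suc r) m = cong₂ _+_ (*-zeroʳ (m C suc r)) (peel-zero r (pred m))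

-- An empty outside carries only the empty clique, so just the summand `s = 0` survives.
peel-[] : ∀ (a : Adjacency X) r m → peel r m (λ s → cliqueCount a s []) ≡ m C r
peel-[] a zero    m = sym (nC0≡1 m)
peel-[] a (suc r) m = trans (cong₂ _+_ (*-identityʳ (m C suc r)) (peel-zero r (pred m))) (+-identityʳ _)

-- The recursion of `peel` is shaped for this identity. A clique through `x` continues in the link
-- of `x`; removing `x` lowers `r`, `m` and `s` by one each, which preserves the coefficient C(m -
-- s, r - s).
peel-∷ : ∀ (a : Adjacency X) r m x xs →
  peel (suc r) m (λ s → cliqueCount a s (x ∷ xs)) ≡
  peel r (pred m) (λ s → cliqueCount a s (filterᵇ (a x) xs)) + peel (suc r) m (λ s → cliqueCount a s xs)
peel-∷ a r m x xs = begin
  (m C suc r) * 1 + peel r (pred m) (λ s → cliqueCount a s ys + cliqueCount a (suc s) xs)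
    ≡⟨ cong ((m C suc r) * 1 +_) (peel-+ r (pred m) (λ s → cliqueCount a s ys) _) ⟩
  (m C suc r) * 1 + (peel r (pred m) (λ s → cliqueCount a s ys) + _)
    ≡⟨ exchange₃ ((m C suc r) * 1) (peel r (pred m) (λ s → cliqueCount a s ys)) _ ⟩
  peel r (pred m) (λ s → cliqueCount a s ys) + peel (suc r) m (λ s → cliqueCount a s xs) ∎
  where
  open ≡-Reasoning
  ys = filterᵇ (a x) xs

C≤peel : ∀ (a : Adjacency X) r m xs → m C r ≤ peel r m (λ s → cliqueCount a s xs)
C≤peel a r m xs = subst (_≤ peel r m (λ s → cliqueCount a s xs)) (peel-[] a r m)
  (peel-mono r m (λ s → cliqueCount-mono {a = a} id s (minimum xs)))

-- The clique A₁ has at most ω vertices, so |A| ≤ m. The condition passes to the link of a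
-- vertex outside A with m and ω decreased by 1, although A₁ need not stay a maximum clique.
record Saturated (a : Adjacency X) (m : ℕ) (L A : List X) : Set where
  constructor saturated
  field
    {ω}      : ℕ
    {A₁ A₂}  : List X
    split    : A ≡ A₁ ++ A₂
    clique   : AllPairs (λ x y → T (a x y)) A₁
    room     : length A₂ + ω ≤ m
    noClique : cliqueCount a (suc ω) (L ++ A) ≡ 0

saturated-link : ∀ {a : Adjacency X} {m x L A} → Saturated a m (x ∷ L) A →
  Saturated a (pred m) (filterᵇ (a x) L) (filterᵇ (a x) A)
-- The clique bound cannot be 0, since `x` alone is a 1-clique. A (1+ω)-clique in the link would
-- extend by `x` to a forbidden (2+ω)-clique.
saturated-link {a = a} {m} {x} {L} (saturated {suc ω} {A₁} {A₂} refl clique room noClique) =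
  saturated (filter-++ P? A₁ A₂) (AllPairs-filter⁺ P? clique)
    (≤-trans (+-monoˡ-≤ ω (length-filter P? A₂)) (pred-mono-≤ (≤-trans (≤-reflexive (sym (+-suc _ ω))) room)))
    (trans (cong (cliqueCount a (suc ω)) (sym (filter-++ P? L (A₁ ++ A₂)))) (m+n≡0⇒m≡0 _ noClique))
  where P? = T? ∘ a x

saturated-tail : ∀ {a : Adjacency X} {m x L A} → Saturated a m (x ∷ L) A → Saturated a m L A
saturated-tail (saturated {ω} split clique room noClique) =
  saturated split clique room (m+n≡0⇒n≡0 _ noClique)

saturated-length : ∀ {a : Adjacency X} {m L A} → Saturated a m L A → length A ≤ m
saturated-length {a = a} {m} {L} (saturated {ω} {A₁} {A₂} refl clique room noClique) = begin
  length (A₁ ++ A₂)       ≡⟨ length-++ A₁ ⟩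
  -- A longer `A₁` would contain a (1+ω)-clique, which `noClique` excludes.
  length A₁ + length A₂   ≤⟨ +-monoˡ-≤ (length A₂) (≮⇒≥ λ ω<A₁ → n≮0 (≤-trans (C>0 ω<A₁)
                               (subst (length A₁ C suc ω ≤_) noClique (≤-trans (cliqueCount≥C (suc ω) clique)
                                 (cliqueCount-mono {a = a} id (suc ω) (++⁺ˡ-⊆ L (++⁺ʳ-⊆ A₂ ⊆-refl))))))) ⟩
  ω + length A₂           ≡⟨ +-comm ω _ ⟩
  length A₂ + ω           ≤⟨ room ⟩
  m                       ∎
  where open ≤-Reasoning

-- Cliques through the first vertex of `L` lie in its link, which is saturated for `pred m`; the
-- others lie in the tail. These are the two terms of `peel-∷`. Once `L` is empty, at most `m`
-- vertices remain.
cliqueCount≤peel : ∀ {a : Adjacency X} {m A} r L → Saturated a m L A →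
  cliqueCount a r (L ++ A) ≤ peel r m (λ s → cliqueCount a s L)
cliqueCount≤peel zero L _ = ≤-refl
cliqueCount≤peel {a = a} {m} {A} (suc r) [] sat = begin
  cliqueCount a (suc r) A  ≤⟨ cliqueCount≤C a (suc r) A ⟩
  length A C suc r         ≤⟨ C-monoˡ-≤ (suc r) (saturated-length sat) ⟩
  m C suc r                ≡⟨ peel-[] a (suc r) m ⟨
  peel (suc r) m (λ s → cliqueCount a s []) ∎
  where open ≤-Reasoning
cliqueCount≤peel {a = a} {m} {A} (suc r) (x ∷ L) sat = begin
  cliqueCount a r (filterᵇ (a x) (L ++ A)) + cliqueCount a (suc r) (L ++ A)
    ≡⟨ cong (λ xs → cliqueCount a r xs + cliqueCount a (suc r) (L ++ A)) (filter-++ (T? ∘ a x) L A) ⟩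
  cliqueCount a r (filterᵇ (a x) L ++ filterᵇ (a x) A) + cliqueCount a (suc r) (L ++ A)
    ≤⟨ +-mono-≤ (cliqueCount≤peel r _ (saturated-link sat)) (cliqueCount≤peel (suc r) L (saturated-tail sat)) ⟩
  _ ≡⟨ peel-∷ a r m x L ⟨
  peel (suc r) m (λ s → cliqueCount a s (x ∷ L)) ∎
  where open ≤-Reasoning

-- Graphs with two edge colours

-- Equality holds at `n = 2 + k`, where a (1+k)-subset omits exactly one element; below that there
-- is at most one such subset.
nCk≤n : ∀ {n k} → n ≤ 2 + k → n C suc k ≤ n
nCk≤n {zero}          _ = z≤n
nCk≤n {suc n} {zero}  _ = ≤-reflexive (nC1≡n (suc n))
nCk≤n {suc n} {suc k} (s≤s n≤2+k) = begin
  suc n C suc (suc k)            ≡⟨ nCk+nC[k+1]≡[n+1]C[k+1] n (suc k) ⟨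
  n C suc k + n C suc (suc k)    ≤⟨ +-mono-≤ (nCk≤n n≤2+k)
                                     (≤-trans (C-monoˡ-≤ (2 + k) n≤2+k) (≤-reflexive (nCn≡1 (2 + k)))) ⟩
  n + 1                          ≡⟨ +-comm n 1 ⟩
  suc n                          ∎
  where open ≤-Reasoning

-- The r-subsets of an (r+2)-set are the complements of its pairs.
cliques≤edges : ∀ (a : Adjacency X) r xs → length xs ≤ 4 + r →
  cliqueCount a (2 + r) xs ≤ cliqueCount a 2 xs
cliques≤edges a zero    xs       _ = ≤-refl
cliques≤edges a (suc r) []       _ = z≤n
cliques≤edges a (suc r) (x ∷ xs) (s≤s xs≤4+r) =
  -- If `x` has at most `3 + r` neighbours, the cliques through it are charged to the edges at `x`.
  -- Otherwise `x` is adjacent to all of `xs` and the roles cross: cliques through `x` are charged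
  -- to edges among its neighbours, and cliques avoiding `x` to the edges at `x`.
  [ sparse (cliques≤edges a (suc r) xs (m≤n⇒m≤1+n xs≤4+r))
  , full (cliques≤edges a r ys (≤-trans (length-filter (T? ∘ a x) xs) xs≤4+r))
  ]′ (≤-<-connex (length ys) (3 + r))
  where
  open ≤-Reasoning
  ys = filterᵇ (a x) xs

  sparse : cliqueCount a (3 + r) xs ≤ cliqueCount a 2 xs → length ys ≤ 3 + r →
    cliqueCount a (3 + r) (x ∷ xs) ≤ cliqueCount a 2 (x ∷ xs)
  sparse ih ys≤3+r = +-mono-≤
    (begin
      cliqueCount a (2 + r) ys  ≤⟨ cliqueCount≤C a (2 + r) ys ⟩
      length ys C (2 + r)       ≤⟨ nCk≤n ys≤3+r ⟩
      length ys                 ≡⟨ cliqueCount-1 a ys ⟨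
      cliqueCount a 1 ys        ∎)
    ih

  full : cliqueCount a (2 + r) ys ≤ cliqueCount a 2 ys → 3 + r < length ys →
    cliqueCount a (3 + r) (x ∷ xs) ≤ cliqueCount a 2 (x ∷ xs)
  full ih 3+r<ys = begin
    cliqueCount a (2 + r) ys + cliqueCount a (3 + r) xs
      ≤⟨ +-mono-≤ ih (cliqueCount≤C a (3 + r) xs) ⟩
    cliqueCount a 2 ys + length xs C (3 + r)
      ≤⟨ +-mono-≤ (cliqueCount-mono {a = a} id 2 (filter-⊆ (T? ∘ a x) xs)) (nCk≤n xs≤4+r) ⟩
    cliqueCount a 2 xs + length xs
      ≤⟨ +-monoʳ-≤ (cliqueCount a 2 xs) (≤-trans xs≤4+r 3+r<ys) ⟩
    cliqueCount a 2 xs + length ys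
      ≡⟨ trans (+-comm (cliqueCount a 2 xs) _) (cong (_+ _) (sym (cliqueCount-1 a ys))) ⟩
    cliqueCount a 1 ys + cliqueCount a 2 xs ∎

length-filterᵇ-∨ : ∀ {p q : X → Bool} → (∀ x → T (p x) → ¬ T (q x)) → ∀ xs →
  length (filterᵇ p xs) + length (filterᵇ q xs) ≡ length (filterᵇ (λ x → p x ∨ q x) xs)
length-filterᵇ-∨ p∧q⇒⊥ [] = refl
length-filterᵇ-∨ {p = p} {q} p∧q⇒⊥ (x ∷ xs) with p x | q x | p∧q⇒⊥ x
... | true  | true  | disj = contradiction _ (disj _)
... | true  | false | _ = cong suc (length-filterᵇ-∨ p∧q⇒⊥ xs)
... | false | true  | _ = trans (+-suc _ _) (cong suc (length-filterᵇ-∨ p∧q⇒⊥ xs))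
... | false | false | _ = length-filterᵇ-∨ p∧q⇒⊥ xs

length-filterᵇ-disjoint : ∀ {p q : X → Bool} → (∀ x → T (p x) → ¬ T (q x)) → ∀ xs →
  length (filterᵇ p xs) + length (filterᵇ q xs) ≤ length xs
length-filterᵇ-disjoint {p = p} {q} p∧q⇒⊥ xs =
  ≤-trans (≤-reflexive (length-filterᵇ-∨ p∧q⇒⊥ xs)) (length-filter (T? ∘ λ x → p x ∨ q x) xs)

module Coloured (blue red : Adjacency X) (disjoint : ∀ x y → T (blue x y) → ¬ T (red x y)) where

  union : Adjacency X
  union x y = blue x y ∨ red x y

  blue-edges+red-edges : ∀ xs → cliqueCount blue 2 xs + cliqueCount red 2 xs ≤ length xs C 2
  blue-edges+red-edges []       = z≤n
  blue-edges+red-edges (x ∷ xs) = begin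
    (cliqueCount blue 1 ys + cliqueCount blue 2 xs) + (cliqueCount red 1 zs + cliqueCount red 2 xs)
      ≡⟨ exchange₄ (cliqueCount blue 1 ys) _ _ _ ⟩
    (cliqueCount blue 1 ys + cliqueCount red 1 zs) + (cliqueCount blue 2 xs + cliqueCount red 2 xs)
      ≤⟨ +-mono-≤ (≤-reflexive (cong₂ _+_ (cliqueCount-1 blue ys) (cliqueCount-1 red zs))) (blue-edges+red-edges xs) ⟩
    (length ys + length zs) + length xs C 2
      ≤⟨ +-monoˡ-≤ _ (length-filterᵇ-disjoint (disjoint x) xs) ⟩
    length xs + length xs C 2
      ≡⟨ cong (_+ length xs C 2) (nC1≡n (length xs)) ⟨
    length xs C 1 + length xs C 2
      ≡⟨ nCk+nC[k+1]≡[n+1]C[k+1] (length xs) 1 ⟩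
    suc (length xs) C 2 ∎
    where
    open ≤-Reasoning
    ys = filterᵇ (blue x) xs
    zs = filterᵇ (red x) xs

  -- Induction on `m`. At `m = 4 + r`, red cliques are traded for red edges, and the pairs number
  -- C(m, 2) = C(m, 2 + r). In the step, a vertex with blue degree b and red degree c contributes at
  -- most b + C(c, 1 + r), which `b+C≤C` bounds so that Pascal's rule applies.
  small : ∀ r {m} xs → 4 + r ≤′ m → length xs ≤ m →
    cliqueCount blue 2 xs + cliqueCount red (2 + r) xs ≤ m C (2 + r)
  small r xs ≤′-refl xs≤m = begin
    cliqueCount blue 2 xs + cliqueCount red (2 + r) xs
      ≤⟨ +-monoʳ-≤ (cliqueCount blue 2 xs) (cliques≤edges red r xs xs≤m) ⟩
    cliqueCount blue 2 xs + cliqueCount red 2 xs  ≤⟨ blue-edges+red-edges xs ⟩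
    length xs C 2                                 ≤⟨ C-monoˡ-≤ 2 xs≤m ⟩
    (4 + r) C 2                                   ≡⟨ nCk≡nC[n∸k] {2} {4 + r} (s≤s (s≤s z≤n)) ⟩
    (4 + r) C (2 + r)                             ∎
    where open ≤-Reasoning
  small r []       (≤′-step r≤m) xs≤m       = z≤n
  small r (x ∷ xs) (≤′-step {m} r≤m) (s≤s xs≤m) = begin
    (cliqueCount blue 1 ys + cliqueCount blue 2 xs) + (cliqueCount red (1 + r) zs + cliqueCount red (2 + r) xs)
      ≡⟨ exchange₄ (cliqueCount blue 1 ys) _ _ _ ⟩
    (cliqueCount blue 1 ys + cliqueCount red (1 + r) zs) + (cliqueCount blue 2 xs + cliqueCount red (2 + r) xs)
      ≤⟨ +-mono-≤ (+-mono-≤ (≤-reflexive (cliqueCount-1 blue ys)) (cliqueCount≤C red (1 + r) zs)) (small r xs r≤m xs≤m) ⟩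
    (length ys + length zs C (1 + r)) + m C (2 + r)
      ≤⟨ +-monoˡ-≤ _ (b+C≤C (length ys) (length zs)
           (≤-trans (length-filterᵇ-disjoint (disjoint x) xs) xs≤m)
           (≤-trans (m≤n+m (2 + r) 2) (≤′⇒≤ r≤m))) ⟩
    m C (1 + r) + m C (2 + r)  ≡⟨ nCk+nC[k+1]≡[n+1]C[k+1] m (suc r) ⟩
    suc m C (2 + r)            ∎
    where
    open ≤-Reasoning
    ys = filterᵇ (blue x) xs
    zs = filterᵇ (red x) xs

  red⇒union : ∀ {x y} → T (red x y) → T (union x y)
  red⇒union {x} {y} r with blue x y
  ... | true  = _
  ... | false = r

  -- `β` and `ρ` stand for the blue and red neighbourhoods of a vertex outside `A`, so the left side
  -- is what this vertex contributes. The induction runs through the later outer vertices `L`; when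
  -- none is left, `b+C≤C` handles the neighbours in `A`.
  neighbourhood : ∀ {β ρ : X → Bool} → (∀ x → T (β x) → ¬ T (ρ x)) →
    let υ = filterᵇ (λ x → β x ∨ ρ x) in
    ∀ {m A} j → suc j < m → ∀ L → Saturated union m (υ L) (υ A) →
    length (filterᵇ β (L ++ A)) + cliqueCount red (suc j) (filterᵇ ρ (L ++ A)) ≤
    peel (suc j) m (λ s → cliqueCount union s (υ L))
  neighbourhood {β} {ρ} disj {m} {A} j j<m [] sat = begin
    length (filterᵇ β A) + cliqueCount red (suc j) (filterᵇ ρ A)
      ≤⟨ +-monoʳ-≤ (length (filterᵇ β A)) (cliqueCount≤C red (suc j) (filterᵇ ρ A)) ⟩
    length (filterᵇ β A) + length (filterᵇ ρ A) C suc j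
      ≤⟨ b+C≤C (length (filterᵇ β A)) _ (≤-trans (≤-reflexive (length-filterᵇ-∨ disj A)) (saturated-length sat)) j<m ⟩
    m C suc j
      ≡⟨ peel-[] union (suc j) m ⟨
    peel (suc j) m (λ s → cliqueCount union s []) ∎
    where open ≤-Reasoning
  neighbourhood {β} {ρ} disj {m} {A} j j<m (y ∷ L) sat with β y | ρ y | disj y
  ... | true  | true  | disj-y = contradiction _ (disj-y _)
  -- A blue neighbour adds 1 on the left, and on the right at least C(m - 1, j), which is positive.
  ... | true  | false | _ = begin
    suc (length (filterᵇ β (L ++ A)) + cliqueCount red (suc j) (filterᵇ ρ (L ++ A)))
      ≤⟨ +-mono-≤ (≤-trans (C>0 (pred-mono-≤ (<⇒≤ j<m))) (C≤peel union j (pred m) (filterᵇ (union y) υL)))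
           (neighbourhood disj j j<m L (saturated-tail sat)) ⟩
    _ ≡⟨ peel-∷ union j m y υL ⟨
    peel (suc j) m (λ s → cliqueCount union s (y ∷ υL)) ∎
    where
    open ≤-Reasoning
    υL = filterᵇ (λ x → β x ∨ ρ x) L
  -- A red neighbour `y` adds the red cliques through `y`. These are also cliques of the union, so
  -- the uncoloured bound in the link of `y` suffices.
  ... | false | true  | _ = begin
    length (filterᵇ β (L ++ A)) + (cliqueCount red j (filterᵇ (red y) ρLA) + cliqueCount red (suc j) ρLA)
      ≡⟨ exchange₃ (length (filterᵇ β (L ++ A))) (cliqueCount red j (filterᵇ (red y) ρLA)) _ ⟩
    cliqueCount red j (filterᵇ (red y) ρLA) + (length (filterᵇ β (L ++ A)) + cliqueCount red (suc j) ρLA)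
      ≤⟨ +-mono-≤ link (neighbourhood disj j j<m L (saturated-tail sat)) ⟩
    _ ≡⟨ peel-∷ union j m y υL ⟨
    peel (suc j) m (λ s → cliqueCount union s (y ∷ υL)) ∎
    where
    open ≤-Reasoning
    υ = λ x → β x ∨ ρ x
    υL = filterᵇ υ L
    ρLA = filterᵇ ρ (L ++ A)
    ρ⇒υ : ∀ {x} → T (ρ x) → T (υ x)
    ρ⇒υ {x} r with β x
    ... | true  = _
    ... | false = r
    link : cliqueCount red j (filterᵇ (red y) ρLA) ≤ peel j (pred m) (λ s → cliqueCount union s (filterᵇ (union y) υL))
    link = begin
      cliqueCount red j (filterᵇ (red y) ρLA)
        ≤⟨ cliqueCount-mono red⇒union j (filterᵇ-⊆ red⇒union (filterᵇ-⊆ ρ⇒υ (⊆-refl {x = L ++ A}))) ⟩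
      cliqueCount union j (filterᵇ (union y) (filterᵇ υ (L ++ A)))
        ≡⟨ cong (cliqueCount union j) (trans (cong (filterᵇ (union y)) (filter-++ (T? ∘ υ) L A))
             (filter-++ (T? ∘ union y) υL (filterᵇ υ A))) ⟩
      cliqueCount union j (filterᵇ (union y) υL ++ filterᵇ (union y) (filterᵇ υ A))
        ≤⟨ cliqueCount≤peel j _ (saturated-link sat) ⟩
      peel j (pred m) (λ s → cliqueCount union s (filterᵇ (union y) υL)) ∎
  ... | false | false | _ = neighbourhood disj j j<m L sat

  -- The coloured counterpart of `cliqueCount≤peel`: `small` settles the case of empty `L`, and
  -- `neighbourhood`, applied with `pred m`, bounds the blue degree of `x` plus the red cliques
  -- through `x`.
  edges+cliques≤peel : ∀ {m A} r → 4 + r ≤ m → ∀ L → Saturated union m L A →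
    cliqueCount blue 2 (L ++ A) + cliqueCount red (2 + r) (L ++ A) ≤
    peel (2 + r) m (λ s → cliqueCount union s L)
  edges+cliques≤peel {m} {A} r r≤m [] sat =
    ≤-trans (small r A (≤⇒≤′ r≤m) (saturated-length sat)) (≤-reflexive (sym (peel-[] union (2 + r) m)))
  edges+cliques≤peel {m} {A} r r≤m (x ∷ L) sat = begin
    (cliqueCount blue 1 ys + cliqueCount blue 2 LA) + (cliqueCount red (1 + r) zs + cliqueCount red (2 + r) LA)
      ≡⟨ exchange₄ (cliqueCount blue 1 ys) _ _ _ ⟩
    (cliqueCount blue 1 ys + cliqueCount red (1 + r) zs) + (cliqueCount blue 2 LA + cliqueCount red (2 + r) LA)
      ≤⟨ +-mono-≤ (≤-trans (≤-reflexive (cong (_+ _) (cliqueCount-1 blue ys)))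
           (neighbourhood (disjoint x) r (≤-trans (n≤1+n _) (pred-mono-≤ r≤m)) L (saturated-link sat)))
           (edges+cliques≤peel r r≤m L (saturated-tail sat)) ⟩
    _ ≡⟨ peel-∷ union (suc r) m x L ⟨
    peel (2 + r) m (λ s → cliqueCount union s (x ∷ L)) ∎
    where
    open ≤-Reasoning
    LA = L ++ A
    ys = filterᵇ (blue x) LA
    zs = filterᵇ (red x) LA

-- Listing cliques and choosing the saturated set

cliques : Adjacency X → ℕ → List X → List (List X)
cliques a zero    xs       = [ [] ]
cliques a (suc r) []       = []
cliques a (suc r) (x ∷ xs) = map (x ∷_) (cliques a r (filterᵇ (a x) xs)) ++ cliques a (suc r) xs

length-cliques : ∀ (a : Adjacency X) r xs → length (cliques a r xs) ≡ cliqueCount a r xs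
length-cliques a zero    xs       = refl
length-cliques a (suc r) []       = refl
length-cliques a (suc r) (x ∷ xs) = trans (length-++ (map (x ∷_) (cliques a r (filterᵇ (a x) xs))))
  (cong₂ _+_ (trans (length-map (x List.∷_) (cliques a r (filterᵇ (a x) xs))) (length-cliques a r _)) (length-cliques a (suc r) xs))

⊆-filterᵇ⁺ : ∀ {p : X → Bool} {xs ys} → xs ⊆ ys → All (T ∘ p) xs → xs ⊆ filterᵇ p ys
⊆-filterᵇ⁺ {p = p} {xs} {ys} xs⊆ys pxs =
  subst (_⊆ filterᵇ p ys) (filter-all (T? ∘ p) pxs) (filterᵇ-⊆ {p = p} id xs⊆ys)

∈-cliques⁺ : ∀ (a : Adjacency X) {ys xs} → ys ⊆ xs → AllPairs (λ x y → T (a x y)) ys →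
  ys ∈ cliques a (length ys) xs
∈-cliques⁺ a {[]}     _          _ = here refl
∈-cliques⁺ a {y ∷ ys} (x ∷ʳ s)   c = ∈-++⁺ʳ _ (∈-cliques⁺ a s c)
∈-cliques⁺ a {y ∷ ys} (refl ∷ s) (p ∷ c) = ∈-++⁺ˡ (∈-map⁺ (y ∷_) (∈-cliques⁺ a (⊆-filterᵇ⁺ s p) c))

∈-cliques⁻ : ∀ (a : Adjacency X) r xs {ys} → ys ∈ cliques a r xs →
  ys ⊆ xs × AllPairs (λ x y → T (a x y)) ys × length ys ≡ r
∈-cliques⁻ a zero    xs       (here refl) = minimum xs , [] , refl
∈-cliques⁻ a (suc r) (x ∷ xs) i with ∈-++⁻ (map (x ∷_) (cliques a r (filterᵇ (a x) xs))) i
... | inj₂ j = let s , c , e = ∈-cliques⁻ a (suc r) xs j in x ∷ʳ s , c , e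
... | inj₁ j with _ , k , refl ← ∈-map⁻ (x ∷_) j =
  let s , c , e = ∈-cliques⁻ a r _ k in
  refl ∷ ⊆-trans s (filter-⊆ (T? ∘ a x) xs) , All-resp-⊆ s (all-filter (T? ∘ a x) xs) ∷ c , cong suc e

cliques-unique : ∀ (a : Adjacency X) r {xs} → Unique xs → Unique (cliques a r xs)
cliques-unique a zero    _  = [] ∷ []
cliques-unique a (suc r) [] = []
cliques-unique a (suc r) {x ∷ xs} u@(_ ∷ u′) = Unique.++⁺
  (Unique.map⁺ ∷-injectiveʳ (cliques-unique a r (Unique.filter⁺ (T? ∘ a x) u′)))
  (cliques-unique a (suc r) u′)
  λ { (i , j) → Unique[x∷xs]⇒x∉xs u
        (Any-resp-⊆ (proj₁ (∈-cliques⁻ a (suc r) xs j)) (∈-map∷⁻ i)) }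

⊆⇒↭++ : ∀ {xs ys : List X} → xs ⊆ ys → ∃ λ zs → ys ↭ xs ++ zs
⊆⇒↭++ []              = [] , refl
⊆⇒↭++ {xs = xs} (y ∷ʳ s) = let zs , p = ⊆⇒↭++ s in
  y ∷ zs , ↭-trans (prep y p) (↭-sym (shift y xs zs))
⊆⇒↭++ (refl ∷ s)      = let zs , p = ⊆⇒↭++ s in zs , prep _ p

cliqueNumber : ∀ (a : Adjacency X) m xs → cliqueCount a (suc m) xs ≡ 0 →
  ∃ λ ω → ω ≤ m × cliqueCount a ω xs ≢ 0 × cliqueCount a (suc ω) xs ≡ 0
-- The empty clique always exists, so the descent from `m` ends here at the latest.
cliqueNumber a zero    xs none = 0 , z≤n , (λ ()) , none
cliqueNumber a (suc m) xs none with cliqueCount a (suc m) xs ≟ 0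
... | no some   = suc m , ≤-refl , some , none
... | yes none′ = let ω , ω≤m , p = cliqueNumber a m xs none′ in ω , m≤n⇒m≤1+n ω≤m , p

clique-exists : ∀ (a : Adjacency X) r xs → cliqueCount a r xs ≢ 0 →
  ∃ λ ys → ys ⊆ xs × AllPairs (λ x y → T (a x y)) ys × length ys ≡ r
clique-exists a r xs some with cliques a r xs in eq
... | []     = contradiction (trans (sym (length-cliques a r xs)) (cong length eq)) some
... | ys ∷ _ = ys , ∈-cliques⁻ a r xs (subst (ys ∈_) (sym eq) (here refl))

-- `A` is a maximum clique `A₁` padded by `m ∸ ω` further vertices, which exist because
-- `m ≤ length xs`.
saturated-split : ∀ {a : Adjacency X} {m xs} → (∀ x y → a x y ≡ a y x) →
  cliqueCount a (suc m) xs ≡ 0 → m ≤ length xs →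
  ∃₂ λ L A → xs ↭ L ++ A × length A ≡ m × Saturated a m L A
saturated-split {a = a} {m} {xs} a-sym none m≤xs
  with ω , ω≤m , some , none′ ← cliqueNumber a m xs none
  with A₁ , s , clique , refl ← clique-exists a ω xs some
  with R , p ← ⊆⇒↭++ s
  = L , A₁ ++ A₂ , q , length≡ , saturated refl clique (≤-reflexive (trans (cong (_+ ω) length₂) (m∸n+n≡m ω≤m)))
      (trans (sym (cliqueCount-↭ a-sym (suc ω) q)) none′)
  where
  A₂ = take (m ∸ ω) R
  L  = drop (m ∸ ω) R
  q : xs ↭ L ++ A₁ ++ A₂
  q = begin
    xs                ↭⟨ p ⟩
    A₁ ++ R           ≡⟨ cong (A₁ ++_) (take++drop≡id (m ∸ ω) R) ⟨
    A₁ ++ A₂ ++ L     ≡⟨ ++-assoc A₁ A₂ L ⟨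
    (A₁ ++ A₂) ++ L   ↭⟨ ++-comm (A₁ ++ A₂) L ⟩
    L ++ A₁ ++ A₂     ∎
    where open PermutationReasoning
  length₂ : length A₂ ≡ m ∸ ω
  length₂ = trans (length-take (m ∸ ω) R) (m≤n⇒m⊓n≡m (m≤n+o⇒m∸n≤o m ω
    (≤-trans m≤xs (≤-reflexive (trans (↭-length p) (length-++ A₁))))))
  length≡ : length (A₁ ++ A₂) ≡ m
  length≡ = trans (length-++ A₁) (trans (cong (ω +_) length₂) (m+[n∸m]≡n ω≤m))

-- Turán graphs

module Multipartite {Y : Set} {m : ℕ} (π : Y → Fin m) where

  distinctParts : Adjacency Y
  distinctParts x y = not (does (π x Fin.≟ π y))

  distinctParts⁺ : ∀ {x y} → π x ≢ π y → T (distinctParts x y)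
  distinctParts⁺ {x} {y} πx≢πy with π x Fin.≟ π y
  ... | yes πx≡πy = πx≢πy πx≡πy
  ... | no  _     = _

  distinctParts⁻ : ∀ {x y} → T (distinctParts x y) → π x ≢ π y
  distinctParts⁻ {x} {y} t with π x Fin.≟ π y
  ... | no πx≢πy = πx≢πy

  distinctParts-sym : ∀ x y → distinctParts x y ≡ distinctParts y x
  distinctParts-sym x y with π x Fin.≟ π y | π y Fin.≟ π x
  ... | yes _ | yes _ = refl
  ... | no  _ | no  _ = refl
  ... | yes p | no ¬p = contradiction (sym p) ¬p
  ... | no ¬p | yes p = contradiction (sym p) ¬p

  Rainbow : List Y → Set
  Rainbow = AllPairs (λ x y → T (distinctParts x y))

  partSize : Fin m → List Y → ℕ
  partSize j ys = length (filter (λ y → π y Fin.≟ j) ys)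

  partSize-↭ : ∀ j {xs ys} → xs ↭ ys → partSize j xs ≡ partSize j ys
  partSize-↭ j p = ↭-length (filter-↭ (λ y → π y Fin.≟ j) p)

  partSize-++ : ∀ j xs ys → partSize j (xs ++ ys) ≡ partSize j xs + partSize j ys
  partSize-++ j xs ys = trans (cong length (filter-++ (λ y → π y Fin.≟ j) xs ys)) (length-++ (filter _ xs))

  partSize-accept : ∀ y ys → partSize (π y) (y ∷ ys) ≡ suc (partSize (π y) ys)
  partSize-accept y ys = cong length (filter-accept (λ z → π z Fin.≟ π y) refl)

  partSize-reject : ∀ {j y} ys → π y ≢ j → partSize j (y ∷ ys) ≡ partSize j ys
  partSize-reject {j} ys πy≢j = cong length (filter-reject (λ z → π z Fin.≟ j) πy≢j)

  partSize>0⁻ : ∀ j ys → 0 < partSize j ys → ∃ λ y → y ∈ ys × π y ≡ j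
  partSize>0⁻ j ys pos with filter (λ y → π y Fin.≟ j) ys in eq
  ... | y ∷ _ = y , ∈-filter⁻ (λ z → π z Fin.≟ j) {xs = ys} (subst (y ∈_) (sym eq) (here refl))

  partSize>0⁺ : ∀ {y ys} → y ∈ ys → 0 < partSize (π y) ys
  partSize>0⁺ {y} i = filter-some (λ z → π z Fin.≟ π y) (Any.map (λ { refl → refl }) i)

  partSize≤1⇒rainbow : ∀ ys → (∀ j → partSize j ys ≤ 1) → Rainbow ys
  partSize≤1⇒rainbow []       _  = []
  partSize≤1⇒rainbow (y ∷ ys) ≤1 =
    All.tabulate (λ {z} z∈ys → distinctParts⁺ λ πy≡πz → <⇒≱ (partSize>0⁺ z∈ys)
      (≤-pred (subst (λ j → suc (partSize j ys) ≤ 1) πy≡πz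
        (subst (_≤ 1) (partSize-accept y ys) (≤1 (π y))))))
    ∷ partSize≤1⇒rainbow ys (λ j → ≤-trans (partSize≤∷ j) (≤1 j))
    where
    partSize≤∷ : ∀ j → partSize j ys ≤ partSize j (y ∷ ys)
    partSize≤∷ j = ≤-trans (m≤n+m _ (partSize j (y ∷ []))) (≤-reflexive (sym (partSize-++ j (y ∷ []) ys)))

  rainbow⇒partSize≤1 : ∀ {ys} → Rainbow ys → ∀ j → partSize j ys ≤ 1
  rainbow⇒partSize≤1 []                j = z≤n
  rainbow⇒partSize≤1 {y ∷ ys} (p ∷ ps) j with π y Fin.≟ j
  ... | no  _    = rainbow⇒partSize≤1 ps j
  ... | yes refl = s≤s (≤-reflexive (cong length (filter-none (λ z → π z Fin.≟ π y)
                     (All.map (λ t πz≡πy → distinctParts⁻ t (sym πz≡πy)) p))))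

  -- At most one vertex of a rainbow list lies in the part of `x`.
  rainbow-filter : ∀ x {ys} → Rainbow ys → length ys ≤ suc (length (filterᵇ (distinctParts x) ys))
  rainbow-filter x []                 = z≤n
  rainbow-filter x {y ∷ ys} (p ∷ ps) with π x Fin.≟ π y
  ... | no  _     = s≤s (rainbow-filter x ps)
  ... | yes πx≡πy = s≤s (≤-reflexive (sym (cong length (filter-all (T? ∘ distinctParts x)
                      (All.map (λ t → distinctParts⁺ λ πx≡πz → distinctParts⁻ t (trans (sym πx≡πy) πx≡πz)) p)))))

  -- The inequality opposite to `cliqueCount≤peel`. Each outer vertex misses at most one member of a
  -- rainbow `A`, so an s-clique outside keeps at least m′ - s common neighbours in `A`, and these
  -- are pairwise adjacent.
  peel≤cliqueCount : ∀ r {m′} L {A} → Rainbow A → m′ ≤ length A →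
    peel r m′ (λ s → cliqueCount distinctParts s L) ≤ cliqueCount distinctParts r (L ++ A)
  peel≤cliqueCount zero    L _ _ = ≤-refl
  peel≤cliqueCount (suc r) {m′} [] {A} rb m′≤A = begin
    peel (suc r) m′ (λ s → cliqueCount distinctParts s [])  ≡⟨ peel-[] distinctParts (suc r) m′ ⟩
    m′ C suc r                                              ≤⟨ C-monoˡ-≤ (suc r) m′≤A ⟩
    length A C suc r                                        ≤⟨ cliqueCount≥C (suc r) rb ⟩
    cliqueCount distinctParts (suc r) A                     ∎
    where open ≤-Reasoning
  peel≤cliqueCount (suc r) {m′} (x ∷ L) {A} rb m′≤A = begin
    peel (suc r) m′ (λ s → cliqueCount distinctParts s (x ∷ L))
      ≡⟨ peel-∷ distinctParts r m′ x L ⟩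
    _ ≤⟨ +-mono-≤ (peel≤cliqueCount r _ (AllPairs-filter⁺ (T? ∘ distinctParts x) rb)
           (pred-mono-≤ (≤-trans m′≤A (rainbow-filter x rb)))) (peel≤cliqueCount (suc r) L rb m′≤A) ⟩
    # r (filterᵇ (distinctParts x) L ++ filterᵇ (distinctParts x) A) + # (suc r) (L ++ A)
      ≡⟨ cong (λ xs → # r xs + # (suc r) (L ++ A)) (filter-++ (T? ∘ distinctParts x) L A) ⟨
    # (suc r) (x ∷ L ++ A) ∎
    where
    open ≤-Reasoning
    # = cliqueCount distinctParts

  rainbow-extract : ∀ {js} → Unique js → ∀ ys → (∀ {j} → j ∈ js → 0 < partSize j ys) →
    ∃₂ λ L A → ys ↭ L ++ A × map π A ≡ js
  rainbow-extract []                ys pos = ys , [] , ↭-reflexive (sym (++-identityʳ ys)) , refl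
  rainbow-extract {j ∷ js} (p ∷ u) ys pos
    with y , y∈ys , refl ← partSize>0⁻ j ys (pos (here refl))
    with ys₁ , ys₂ , refl ← ∈-∃++ y∈ys
    with L , A , q , refl ← rainbow-extract u (ys₁ ++ ys₂) (λ {j′} j′∈js →
           subst (0 <_) (trans (partSize-↭ j′ (shift y ys₁ ys₂)) (partSize-reject _ (All.lookup p j′∈js)))
             (pos (there j′∈js)))
    = L , y ∷ A , ↭-trans (shift y ys₁ ys₂) (↭-trans (prep y q) (↭-sym (shift y L A))) , refl

  -- This form of balance passes from `suc q` to `q` when one vertex is removed from every part,
  -- which makes `q` the induction variable of `zykov`.
  BalancedList : ℕ → List Y → Set
  BalancedList q ys = ∀ j → q ≤ partSize j ys × partSize j ys ≤ suc q

  balanced-split : ∀ {q} ys → BalancedList (suc q) ys →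
    ∃₂ λ L A → ys ↭ L ++ A × length A ≡ m × Rainbow A × BalancedList q L
  balanced-split {q} ys bal
    with L , A , p , πA≡ ← rainbow-extract (Unique.allFin⁺ m) ys (λ {j} _ → ≤-trans z<s (proj₁ (bal j)))
    = L , A , p , trans (sym (length-map π A)) (trans (cong length πA≡) (length-tabulate id)) , rainbow , bal′
    where
    rainbow : Rainbow A
    rainbow = AllPairs.map distinctParts⁺ (AllPairs-map⁻ (subst Unique (sym πA≡) (Unique.allFin⁺ m)))
    one : ∀ j → partSize j A ≡ 1
    one j with y , y∈A , refl ← ∈-map⁻ π (subst (j ∈_) (sym πA≡) (∈-allFin j)) =
      ≤-antisym (rainbow⇒partSize≤1 rainbow j) (partSize>0⁺ y∈A)
    removed : ∀ j → partSize j ys ≡ suc (partSize j L)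
    removed j = trans (partSize-↭ j p) (trans (partSize-++ j L A) (trans (cong (partSize j L +_) (one j)) (+-comm _ 1)))
    bal′ : BalancedList q L
    bal′ j = ≤-pred (subst (suc q ≤_) (removed j) (proj₁ (bal j))) , ≤-pred (subst (_≤ suc (suc q)) (removed j) (proj₂ (bal j)))

  -- Induction on `q`. For `q = 0` every part has at most one vertex, so the multipartite graph on
  -- `ys` is complete. Otherwise `saturated-peel` removes `m` vertices from both sides.
  zykov : ∀ {a : Adjacency X} → (∀ x y → a x y ≡ a y x) → ∀ q {xs ys} →
    cliqueCount a (suc m) xs ≡ 0 → length xs ≡ length ys → BalancedList q ys →
    ∀ r → cliqueCount a r xs ≤ cliqueCount distinctParts r ys

  -- A saturated `A` is removed on one side and a transversal `A′` on the other. The remainders have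
  -- equal length, `zykov` for `q` compares their cliques, and `peel≤cliqueCount` puts `A′` back.
  -- The bound stays in terms of `L` so that both `zykov` and `coloured-zykov` can finish from it.
  saturated-peel : ∀ {a : Adjacency X} → (∀ x y → a x y ≡ a y x) → ∀ q {xs ys} →
    cliqueCount a (suc m) xs ≡ 0 → length xs ≡ length ys → BalancedList (suc q) ys →
    ∃₂ λ L A → xs ↭ L ++ A × Saturated a m L A ×
      (∀ r → peel r m (λ s → cliqueCount a s L) ≤ cliqueCount distinctParts r ys)

  zykov {a = a} a-sym zero {xs} {ys} none eq bal r = begin
    cliqueCount a r xs              ≤⟨ cliqueCount≤C a r xs ⟩
    length xs C r                   ≡⟨ cong (_C r) eq ⟩
    length ys C r                   ≤⟨ cliqueCount≥C r (partSize≤1⇒rainbow ys (proj₂ ∘ bal)) ⟩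
    cliqueCount distinctParts r ys  ∎
    where open ≤-Reasoning
  zykov {a = a} a-sym (suc q) {xs} {ys} none eq bal r
    with L , A , p , sat , peel≤ ← saturated-peel a-sym q none eq bal = begin
    cliqueCount a r xs                  ≡⟨ cliqueCount-↭ a-sym r p ⟩
    cliqueCount a r (L ++ A)            ≤⟨ cliqueCount≤peel r L sat ⟩
    peel r m (λ s → cliqueCount a s L)  ≤⟨ peel≤ r ⟩
    cliqueCount distinctParts r ys      ∎
    where open ≤-Reasoning

  saturated-peel {a = a} a-sym q {xs} {ys} none eq bal
    with L′ , A′ , p′ , A′≡m , rainbow , bal′ ← balanced-split ys bal
    with L , A , p , A≡m , sat ← saturated-split a-sym none (≤-trans (≤-reflexive (sym A′≡m))
           (≤-trans (m≤n+m (length A′) (length L′))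
             (≤-reflexive (trans (sym (length-++ L′)) (trans (sym (↭-length p′)) (sym eq))))))
    = L , A , p , sat , λ r → begin
      peel r m (λ s → cliqueCount a s L)
        ≤⟨ peel-mono r m (zykov a-sym q noneL L≡L′ bal′) ⟩
      peel r m (λ s → cliqueCount distinctParts s L′)
        ≤⟨ peel≤cliqueCount r L′ rainbow (≤-reflexive (sym A′≡m)) ⟩
      cliqueCount distinctParts r (L′ ++ A′)
        ≡⟨ cliqueCount-↭ distinctParts-sym r p′ ⟨
      cliqueCount distinctParts r ys ∎
    where
    open ≤-Reasoning
    noneL : cliqueCount a (suc m) L ≡ 0
    noneL = n≤0⇒n≡0 (subst (cliqueCount a (suc m) L ≤_) (trans (sym (cliqueCount-↭ a-sym (suc m) p)) none)
      (cliqueCount-mono {a = a} id (suc m) {L} {L ++ A} (++⁺ʳ-⊆ A ⊆-refl)))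
    L≡L′ : length L ≡ length L′
    L≡L′ = +-cancelʳ-≡ m _ _ (trans (cong (length L +_) (sym A≡m)) (trans (sym (length-++ L))
      (trans (sym (↭-length p)) (trans eq (trans (↭-length p′) (trans (length-++ L′) (cong (length L′ +_) A′≡m)))))))

  -- A single peeling suffices: `edges+cliques≤peel` bounds the coloured count by uncoloured clique
  -- counts outside `A`, and the bound of `saturated-peel`, based on `zykov`, takes over.
  coloured-zykov : ∀ {blue red : Adjacency X} →
    (∀ x y → blue x y ≡ blue y x) → (∀ x y → red x y ≡ red y x) →
    (disjoint : ∀ x y → T (blue x y) → ¬ T (red x y)) → ∀ q {xs ys} →
    cliqueCount (λ x y → blue x y ∨ red x y) (suc m) xs ≡ 0 →
    length xs ≡ length ys → BalancedList (suc q) ys → ∀ r → 4 + r ≤ m →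
    cliqueCount blue 2 xs + cliqueCount red (2 + r) xs ≤ cliqueCount distinctParts (2 + r) ys
  coloured-zykov {blue = blue} {red} blue-sym red-sym disjoint q {xs} {ys} none eq bal r r≤m
    with L , A , p , sat , peel≤ ← saturated-peel (λ x y → cong₂ _∨_ (blue-sym x y) (red-sym x y)) q {xs} {ys} none eq bal = begin
    cliqueCount blue 2 xs + cliqueCount red (2 + r) xs
      ≡⟨ cong₂ _+_ (cliqueCount-↭ blue-sym 2 p) (cliqueCount-↭ red-sym (2 + r) p) ⟩
    cliqueCount blue 2 (L ++ A) + cliqueCount red (2 + r) (L ++ A)
      ≤⟨ edges+cliques≤peel r r≤m L sat ⟩
    peel (2 + r) m (λ s → cliqueCount union s L)
      ≤⟨ peel≤ (2 + r) ⟩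
    cliqueCount distinctParts (2 + r) ys ∎
    where
    open ≤-Reasoning
    open Coloured blue red disjoint

-- Matchings between hyperedges and pairs

AllPairs-++⁻ˡ : ∀ {R : X → X → Set} {xs ys} → AllPairs R (xs ++ ys) → AllPairs R xs
AllPairs-++⁻ˡ {xs = []}     _        = []
AllPairs-++⁻ˡ {xs = x ∷ xs} (p ∷ ps) = ++⁻ˡ xs p ∷ AllPairs-++⁻ˡ ps

AllPairs-++⁻ʳ : ∀ {R : X → X → Set} xs {ys} → AllPairs R (xs ++ ys) → AllPairs R ys
AllPairs-++⁻ʳ []       ps       = ps
AllPairs-++⁻ʳ (x ∷ xs) (_ ∷ ps) = AllPairs-++⁻ʳ xs ps

unique-++⇒disjoint : ∀ {xs ys : List X} → Unique (xs ++ ys) → ∀ {x} → x ∈ xs → ¬ x ∈ ys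
unique-++⇒disjoint {xs = x ∷ xs} (p ∷ ps) (here refl) x∈ys = All.lookup (++⁻ʳ xs p) x∈ys refl
unique-++⇒disjoint {xs = x ∷ xs} (p ∷ ps) (there i)   x∈ys = unique-++⇒disjoint ps i x∈ys

AllPairs-resp-⊆ : ∀ {R : X → X → Set} {xs ys} → xs ⊆ ys → AllPairs R ys → AllPairs R xs
AllPairs-resp-⊆ []         []       = []
AllPairs-resp-⊆ (y ∷ʳ s)   (_ ∷ ps) = AllPairs-resp-⊆ s ps
AllPairs-resp-⊆ (refl ∷ s) (p ∷ ps) = All-resp-⊆ s p ∷ AllPairs-resp-⊆ s ps

module Matching {E P : Set} (_≟ᴾ_ : DecidableEquality P) where

  open DecMembership _≟ᴾ_ using (_∈?_)

  Incident : (E → List P) → List (E × P) → Set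
  Incident nb = All (λ (e , p) → p ∈ nb e)

  ≢? : ∀ (p q : P) → Dec (q ≢ p)
  ≢? p q = ¬? (q ≟ᴾ p)

  -- The outcome of switching the matching along an alternating path: `end`, a member of `N`,
  -- becomes free while the left ends stay the same. A new left vertex with neighbourhood `N` can
  -- then be matched to `end`.
  record Augmentation (nb : E → List P) (N : List P) (M : List (E × P)) : Set where
    constructor augmentation
    field
      {end}     : P
      {matched} : List (E × P)
      end∈      : end ∈ N
      sameLeft  : map proj₁ matched ↭ map proj₁ M
      incident  : Incident nb matched
      unique    : Unique (end ∷ map proj₂ matched)

  -- The outcome of a failed search from `N`: `inner` consists of the matching edges reached, and no
  -- incidence leads from their left ends to any further right vertex.
  record Closed (nb : E → List P) (N : List P) (M : List (E × P)) : Set where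
    constructor closed
    field
      {inner outer} : List (E × P)
      split         : M ↭ inner ++ outer
      initial         : ∀ {q} → q ∈ N → q ∈ map proj₂ inner
      closure       : ∀ {x} → x ∈ inner → ∀ {q} → q ∈ nb (proj₁ x) → q ∈ map proj₂ inner

  -- If p ∈ N is matched to y, then discard p and y, and let the neighbours of y join N.
  augment : ∀ k nb N M → length M ≤ k → Incident nb M → Unique (map proj₂ M) →
    Augmentation nb N M ⊎ Closed nb N M
  augment k nb []      M len inc u = inj₂ (closed {inner = []} refl (λ ()) (λ ()))
  augment k nb (p ∷ N) M len inc u with p ∈? map proj₂ M
  ... | no p∉M = inj₁ (augmentation (here refl) refl inc (¬Any⇒All¬ _ p∉M ∷ u))
  ... | yes p∈M with (y , _) , yp∈M , refl ← ∈-map⁻ proj₂ p∈M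
                with M₁ , M₂ , refl ← ∈-∃++ yp∈M = step k len
    where
    M₀ = M₁ ++ M₂
    perm : M₁ ++ (y , p) ∷ M₂ ↭ (y , p) ∷ M₀
    perm = shift (y , p) M₁ M₂
    u₀ : Unique (p ∷ map proj₂ M₀)
    u₀ = Unique-resp-↭ (setoid P) (↭⇒↭ₛ (↭-map⁺ proj₂ perm)) u
    inc₀ : Incident nb ((y , p) ∷ M₀)
    inc₀ = All-resp-↭ perm inc
    nb′ : E → List P
    nb′ e = filter (≢? p) (nb e)
    N′ = filter (≢? p) (N ++ nb y)
    inc′ : Incident nb′ M₀
    inc′ = All.zipWith (λ { (q∈nb , p≢q) → ∈-filter⁺ (≢? p) q∈nb (p≢q ∘ sym) })
      (All.tail inc₀ , All-map⁻ (AllPairs.head u₀))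

    p-unique : ∀ {M′} → Incident nb′ M′ → All (p ≢_) (map proj₂ M′)
    p-unique inc′ = All-map⁺ (All.map (λ {x} q∈nb′ p≡q → proj₂ (∈-filter⁻ (≢? p) {xs = nb (proj₁ x)} q∈nb′) (sym p≡q)) inc′)

    weaken : ∀ {M′} → Incident nb′ M′ → Incident nb M′
    weaken = All.map (λ {x} q∈nb′ → proj₁ (∈-filter⁻ (≢? p) {xs = nb (proj₁ x)} q∈nb′))

    left : ∀ {M′} → map proj₁ M′ ↭ map proj₁ M₀ → y ∷ map proj₁ M′ ↭ map proj₁ (M₁ ++ (y , p) ∷ M₂)
    left s = ↭-trans (prep y s) (↭-sym (↭-map⁺ proj₁ perm))

    extend : Augmentation nb′ N′ M₀ ⊎ Closed nb′ N′ M₀ →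
      Augmentation nb (p ∷ N) (M₁ ++ (y , p) ∷ M₂) ⊎ Closed nb (p ∷ N) (M₁ ++ (y , p) ∷ M₂)
    extend (inj₁ (augmentation {p′} {M′} p′∈N′ s i (p′∉M′ ∷ u′)))
      with p′∈ , p′≢p ← ∈-filter⁻ (≢? p) {xs = N ++ nb y} p′∈N′ with ∈-++⁻ N p′∈
    -- The freed vertex already lies in `N`, so `y` keeps `p`.
    ... | inj₁ p′∈N  = inj₁ (augmentation {matched = (y , p) ∷ M′} (there p′∈N) (left s)
          (All.head inc₀ ∷ weaken i) ((p′≢p ∷ p′∉M′) ∷ p-unique i ∷ u′))
    -- The freed vertex is a neighbour of `y`: rematching `y` to it frees `p`, which lies in the
    -- original start set.
    ... | inj₂ p′∈nb = inj₁ (augmentation {matched = (y , p′) ∷ M′} (here refl) (left s)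
          (p′∈nb ∷ weaken i) ((p′≢p ∘ sym ∷ p-unique i) ∷ p′∉M′ ∷ u′))
    -- The recursive search ignored `p`; adding `(y , p)` to `inner` restores it, and the neighbours
    -- of `y` are reached because they had joined `N′`.
    extend (inj₂ (closed {inner} s initial closure)) = inj₂ (closed {inner = (y , p) ∷ inner}
      (↭-trans perm (prep (y , p) s))
      (λ { (here refl) → here refl ; (there q∈N) → reach initial (∈-++⁺ˡ q∈N) })
      (λ { (here refl) q∈nb → reach initial (∈-++⁺ʳ N q∈nb) ; (there x∈) → reach (closure x∈) }))
      where
      reach : ∀ {qs} → (∀ {q} → q ∈ filter (≢? p) qs → q ∈ map proj₂ inner) →
        ∀ {q} → q ∈ qs → q ∈ p ∷ map proj₂ inner
      reach c {q} q∈qs with q ≟ᴾ p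
      ... | yes q≡p = here q≡p
      ... | no  q≢p = there (c (∈-filter⁺ (≢? p) q∈qs q≢p))

    step : ∀ k → length (M₁ ++ (y , p) ∷ M₂) ≤ k →
      Augmentation nb (p ∷ N) (M₁ ++ (y , p) ∷ M₂) ⊎ Closed nb (p ∷ N) (M₁ ++ (y , p) ∷ M₂)
    step zero    len = contradiction (≤-trans (≤-reflexive (sym (↭-length perm))) len) λ ()
    step (suc k) len = extend (augment k nb′ N′ M₀
      (≤-pred (≤-trans (≤-reflexive (sym (↭-length perm))) len)) inc′ (AllPairs.tail u₀))

  -- König's theorem: R and B form a matching, and the right ends of R together with the
  -- left ends of B cover every incidence.
  record König (nb : E → List P) (es : List E) : Set where
    constructor könig
    field
      free      : List E
      R B       : List (E × P)
      split     : es ↭ (free ++ map proj₁ R) ++ map proj₁ B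
      incidentR : Incident nb R
      incidentB : Incident nb B
      uniqueR   : Unique (map proj₂ R)
      uniqueB   : Unique (map proj₂ B)
      disjoint  : ∀ {p} → p ∈ map proj₂ R → ¬ p ∈ map proj₂ B
      covered   : ∀ {e} → e ∈ free ++ map proj₁ R → ∀ {p} → p ∈ nb e → p ∈ map proj₂ R

  minimumCover : ∀ nb es → König nb es
  minimumCover nb [] = könig [] [] [] refl [] [] [] [] (λ ()) (λ ())
  minimumCover nb (e ∷ es)
    with könig Z R B split incR incB uR uB disj cov ← minimumCover nb es
    = extend (augment (length B) nb′ (nb′ e) B ≤-refl
        (All.tabulate λ {x} x∈B → ∈-filter⁺ unused? (All.lookup incB x∈B) λ p∈R → disj p∈R (∈-map⁺ proj₂ x∈B)) uB)
    where
    unused? : ∀ p → Dec (¬ p ∈ map proj₂ R)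
    unused? p = ¬? (p ∈? map proj₂ R)
    nb′ : E → List P
    nb′ e = filter unused? (nb e)

    extend : Augmentation nb′ (nb′ e) B ⊎ Closed nb′ (nb′ e) B → König nb (e ∷ es)
    extend (inj₁ (augmentation {p} {B′} p∈nb′ same inc u)) = könig Z R ((e , p) ∷ B′)
      (↭-trans (prep e (↭-trans split (↭-++⁺ˡ (Z ++ map proj₁ R) (↭-sym same))))
        (↭-sym (shift e (Z ++ map proj₁ R) (map proj₁ B′))))
      incR (All.map (λ {x} q → proj₁ (used (proj₁ x) q)) inc′) uR u
      (λ { q∈R q∈B → All.lookup (All-map⁺ (All.map (λ {x} q → proj₂ (used (proj₁ x) q)) inc′)) q∈B q∈R })
      cov
      where
      inc′ : Incident nb′ ((e , p) ∷ B′)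
      inc′ = p∈nb′ ∷ inc
      used : ∀ e {q} → q ∈ nb′ e → q ∈ nb e × ¬ q ∈ map proj₂ R
      used e = ∈-filter⁻ unused? {xs = nb e}
    extend (inj₂ (closed {X} {Y} split′ initial closure)) = könig (e ∷ Z) (R ++ X) Y
      (prep e (begin
        es                                              ↭⟨ split ⟩
        (Z ++ map proj₁ R) ++ map proj₁ B               ↭⟨ ↭-++⁺ˡ (Z ++ map proj₁ R) (↭-map⁺ proj₁ split′) ⟩
        (Z ++ map proj₁ R) ++ map proj₁ (X ++ Y)        ≡⟨ cong ((Z ++ map proj₁ R) ++_) (map-++ proj₁ X Y) ⟩
        (Z ++ map proj₁ R) ++ map proj₁ X ++ map proj₁ Y ≡⟨ ++-assoc (Z ++ map proj₁ R) (map proj₁ X) _ ⟨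
        ((Z ++ map proj₁ R) ++ map proj₁ X) ++ map proj₁ Y ≡⟨ cong (_++ map proj₁ Y) (left≡) ⟨
        (Z ++ map proj₁ (R ++ X)) ++ map proj₁ Y        ∎))
      (All-++⁺ incR (++⁻ˡ X incXY)) (++⁻ʳ X incXY)
      (subst Unique (sym (map-++ proj₂ R X)) (Unique.++⁺ uR (AllPairs-++⁻ˡ uXY) λ (q∈R , q∈X) →
        disj q∈R (∈-resp-↭ (↭-sym (↭-map⁺ proj₂ split′)) (subst (_ ∈_) (sym (map-++ proj₂ X Y)) (∈-++⁺ˡ q∈X)))))
      (AllPairs-++⁻ʳ (map proj₂ X) uXY)
      disj′
      cov′
      where
      open PermutationReasoning
      left≡ : Z ++ map proj₁ (R ++ X) ≡ (Z ++ map proj₁ R) ++ map proj₁ X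
      left≡ = trans (cong (Z ++_) (map-++ proj₁ R X)) (sym (++-assoc Z _ _))
      incXY : Incident nb (X ++ Y)
      incXY = All-resp-↭ split′ incB
      uXY : Unique (map proj₂ X ++ map proj₂ Y)
      uXY = subst Unique (map-++ proj₂ X Y) (Unique-resp-↭ (setoid P) (↭⇒↭ₛ (↭-map⁺ proj₂ split′)) uB)
      disj′ : ∀ {p} → p ∈ map proj₂ (R ++ X) → ¬ p ∈ map proj₂ Y
      disj′ {p} p∈RX p∈Y with ∈-++⁻ (map proj₂ R) (subst (p ∈_) (map-++ proj₂ R X) p∈RX)
      ... | inj₁ p∈R = disj p∈R (∈-resp-↭ (↭-sym (↭-map⁺ proj₂ split′))
                         (subst (p ∈_) (sym (map-++ proj₂ X Y)) (∈-++⁺ʳ (map proj₂ X) p∈Y)))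
      ... | inj₂ p∈X = unique-++⇒disjoint uXY p∈X p∈Y
      reach : ∀ {e} → (∀ {p} → p ∈ nb′ e → p ∈ map proj₂ X) → ∀ {p} → p ∈ nb e → p ∈ map proj₂ (R ++ X)
      reach c {p} p∈nb with p ∈? map proj₂ R
      ... | yes p∈R = subst (p ∈_) (sym (map-++ proj₂ R X)) (∈-++⁺ˡ p∈R)
      ... | no  p∉R = subst (p ∈_) (sym (map-++ proj₂ R X)) (∈-++⁺ʳ _ (c (∈-filter⁺ unused? p∈nb p∉R)))
      cov′ : ∀ {e′} → e′ ∈ (e ∷ Z) ++ map proj₁ (R ++ X) → ∀ {p} → p ∈ nb e′ → p ∈ map proj₂ (R ++ X)
      cov′ (here refl) = reach initial
      cov′ (there e′∈) with ∈-++⁻ (Z ++ map proj₁ R) (subst (_ ∈_) left≡ e′∈)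
      ... | inj₁ e′∈ZR = λ p∈nb → subst (_ ∈_) (sym (map-++ proj₂ R X)) (∈-++⁺ˡ (cov e′∈ZR p∈nb))
      ... | inj₂ e′∈X with _ , x∈X , refl ← ∈-map⁻ proj₁ e′∈X = reach (closure x∈X)

-- Lists without repetitions

unique-⊆⇒length≤ : ∀ {xs ys : List X} → Unique xs → (∀ {x} → x ∈ xs → x ∈ ys) → length xs ≤ length ys
unique-⊆⇒length≤ [] _ = z≤n
unique-⊆⇒length≤ {xs = x ∷ xs} {ys} (p ∷ u) xs⊆ys with ys₁ , ys₂ , refl ← ∈-∃++ (xs⊆ys (here refl)) = begin
  suc (length xs)            ≤⟨ s≤s (unique-⊆⇒length≤ u xs⊆) ⟩
  length (x ∷ ys₁ ++ ys₂)    ≡⟨ ↭-length (shift x ys₁ ys₂) ⟨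
  length (ys₁ ++ x ∷ ys₂)    ∎
  where
  open ≤-Reasoning
  xs⊆ : ∀ {y} → y ∈ xs → y ∈ ys₁ ++ ys₂
  xs⊆ y∈xs with ∈-resp-↭ (shift x ys₁ ys₂) (xs⊆ys (there y∈xs))
  ... | here refl = contradiction refl (All.lookup p y∈xs)
  ... | there i   = i

lookup-injective : ∀ {xs : List X} → Unique xs → ∀ {i j} → lookup xs i ≡ lookup xs j → i ≡ j
lookup-injective (p ∷ u) {zero}  {zero}  _  = refl
lookup-injective (p ∷ u) {zero}  {suc j} eq = contradiction eq (All.lookup p (∈-lookup j))
lookup-injective (p ∷ u) {suc i} {zero}  eq = contradiction (sym eq) (All.lookup p (∈-lookup i))
lookup-injective (p ∷ u) {suc i} {suc j} eq = cong suc (lookup-injective u eq)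

unique⇒allPairs : ∀ {R : X → X → Set} {xs} → Unique xs →
  (∀ {x y} → x ∈ xs → y ∈ xs → x ≢ y → R x y) → AllPairs R xs
unique⇒allPairs []      _ = []
unique⇒allPairs (p ∷ u) r =
  All.tabulate (λ y∈xs → r (here refl) (there y∈xs) (All.lookup p y∈xs))
  ∷ unique⇒allPairs u (λ x∈ y∈ → r (there x∈) (there y∈))

unique-map⇒functional : ∀ {Y : Set} {ps : List (X × Y)} → Unique (map proj₁ ps) →
  ∀ {x y z} → (x , y) ∈ ps → (x , z) ∈ ps → y ≡ z
unique-map⇒functional (p ∷ u) (here refl) (here refl) = refl
unique-map⇒functional (p ∷ u) (here refl) (there j)   = contradiction refl (All.lookup p (∈-map⁺ proj₁ j))
unique-map⇒functional (p ∷ u) (there i)   (here refl) = contradiction refl (All.lookup p (∈-map⁺ proj₁ i))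
unique-map⇒functional (p ∷ u) (there i)   (there j)   = unique-map⇒functional u i j

-- Subsets as increasing lists

elements : ∀ {n} → Subset n → List (Fin n)
elements []            = []
elements (inside  ∷ s) = zero ∷ map suc (elements s)
elements (outside ∷ s) = map suc (elements s)

length-elements : ∀ {n} (s : Subset n) → length (elements s) ≡ ∣ s ∣
length-elements []            = refl
length-elements (inside  ∷ s) = cong suc (trans (length-map suc (elements s)) (length-elements s))
length-elements (outside ∷ s) = trans (length-map suc (elements s)) (length-elements s)

∈-elements⁺ : ∀ {n} {s : Subset n} {u} → u ∈ˢ s → u ∈ elements s
∈-elements⁺ {s = inside  ∷ s} here      = here refl
∈-elements⁺ {s = inside  ∷ s} (there i) = there (∈-map⁺ suc (∈-elements⁺ i))
∈-elements⁺ {s = outside ∷ s} (there i) = ∈-map⁺ suc (∈-elements⁺ i)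

∈-elements⁻ : ∀ {n} {s : Subset n} {u} → u ∈ elements s → u ∈ˢ s
∈-elements⁻ {s = inside  ∷ s} (here refl) = here
∈-elements⁻ {s = inside  ∷ s} (there i) with _ , j , refl ← ∈-map⁻ suc i = there (∈-elements⁻ j)
∈-elements⁻ {s = outside ∷ s} i         with _ , j , refl ← ∈-map⁻ suc i = there (∈-elements⁻ j)

elements-injective : ∀ {n} {s t : Subset n} → elements s ≡ elements t → s ≡ t
elements-injective eq = ⊆-antisym
  (λ i → ∈-elements⁻ (subst (_ ∈_) eq (∈-elements⁺ i)))
  (λ i → ∈-elements⁻ (subst (_ ∈_) (sym eq) (∈-elements⁺ i)))

allFin-suc : ∀ n → allFin (suc n) ≡ zero ∷ map suc (allFin n)
allFin-suc n = cong (zero ∷_) (sym (map-tabulate id suc))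

elements-⊆-allFin : ∀ {n} (s : Subset n) → elements s ⊆ allFin n
elements-⊆-allFin [] = []
elements-⊆-allFin {suc n} (inside  ∷ s) =
  subst (elements (inside ∷ s) ⊆_) (sym (allFin-suc n)) (refl ∷ ⊆-map⁺ suc (elements-⊆-allFin s))
elements-⊆-allFin {suc n} (outside ∷ s) =
  subst (elements (outside ∷ s) ⊆_) (sym (allFin-suc n)) (zero ∷ʳ ⊆-map⁺ suc (elements-⊆-allFin s))

elements-unique : ∀ {n} (s : Subset n) → Unique (elements s)
elements-unique s = AllPairs-resp-⊆ (elements-⊆-allFin s) (Unique.allFin⁺ _)

⊆-map⁻ : ∀ {Y : Set} (f : X → Y) {xs ys} → ys ⊆ map f xs → ∃ λ zs → zs ⊆ xs × ys ≡ map f zs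
⊆-map⁻ f {[]}     []         = [] , [] , refl
⊆-map⁻ f {x ∷ xs} (_ ∷ʳ s)   = let zs , t , eq = ⊆-map⁻ f s in zs , x ∷ʳ t , eq
⊆-map⁻ f {x ∷ xs} (refl ∷ s) = let zs , t , eq = ⊆-map⁻ f s in x ∷ zs , refl ∷ t , cong (f x ∷_) eq

elements-surjective : ∀ {n} {us : List (Fin n)} → us ⊆ allFin n → ∃ λ s → elements s ≡ us
elements-surjective {zero}  [] = [] , refl
elements-surjective {suc n} {us} us⊆ with subst (us ⊆_) (allFin-suc n) us⊆
... | refl ∷ t with _ , t′ , refl ← ⊆-map⁻ suc t with s , refl ← elements-surjective t′ = inside ∷ s , refl
... | _ ∷ʳ t   with _ , t′ , refl ← ⊆-map⁻ suc t with s , refl ← elements-surjective t′ = outside ∷ s , refl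

pair : ∀ {n} → Fin n → Fin n → Subset n
pair u v = ⁅ u ⁆ ∪ ⁅ v ⁆

∈-pair⁻ : ∀ {n} {u v w : Fin n} → w ∈ˢ pair u v → w ≡ u ⊎ w ≡ v
∈-pair⁻ {u = u} {v} i with x∈p∪q⁻ ⁅ u ⁆ ⁅ v ⁆ i
... | inj₁ j = inj₁ (x∈⁅y⁆⇒x≡y u j)
... | inj₂ j = inj₂ (x∈⁅y⁆⇒x≡y v j)

∈-pairˡ : ∀ {n} (u v : Fin n) → u ∈ˢ pair u v
∈-pairˡ u v = x∈p∪q⁺ (inj₁ (x∈⁅x⁆ u))

∈-pairʳ : ∀ {n} (u v : Fin n) → v ∈ˢ pair u v
∈-pairʳ u v = x∈p∪q⁺ {p = ⁅ u ⁆} (inj₂ (x∈⁅x⁆ v))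

pair-⊆ : ∀ {n} {s : Subset n} {u v} → u ∈ˢ s → v ∈ˢ s → pair u v ⊆ˢ s
pair-⊆ u∈s v∈s i = [ (λ { refl → u∈s }) , (λ { refl → v∈s }) ]′ (∈-pair⁻ i)

∣pair∣ : ∀ {n} {u v : Fin n} → u ≢ v → ∣ pair u v ∣ ≡ 2
∣pair∣ {u = zero}  {zero}  u≢v = contradiction refl u≢v
∣pair∣ {u = zero}  {suc v} _   = cong suc (trans (cong ∣_∣ (∪-identityˡ ⁅ v ⁆)) (∣⁅x⁆∣≡1 v))
∣pair∣ {u = suc u} {zero}  _   = cong suc (trans (cong ∣_∣ (∪-identityʳ ⁅ u ⁆)) (∣⁅x⁆∣≡1 u))
∣pair∣ {u = suc u} {suc v} u≢v = ∣pair∣ (u≢v ∘ cong suc)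

pair≡ : ∀ {n} {s : Subset n} {u v} → ∣ s ∣ ≡ 2 → u ∈ˢ s → v ∈ˢ s → u ≢ v → pair u v ≡ s
pair≡ {s = s} {u} {v} ∣s∣≡2 u∈s v∈s u≢v = ⊆-antisym (pair-⊆ u∈s v∈s) λ {w} w∈s →
  decidable-stable (w ∈ˢ? pair u v) λ w∉ →
    <-irrefl (trans (∣pair∣ u≢v) (sym ∣s∣≡2)) (p⊂q⇒∣p∣<∣q∣ (pair-⊆ u∈s v∈s , w , w∈s , w∉))

2≤∣∣⁺ : ∀ {n} {s : Subset n} {u v} → u ∈ˢ s → v ∈ˢ s → u ≢ v → 2 ≤ ∣ s ∣
2≤∣∣⁺ {s = s} u∈s v∈s u≢v = subst (_≤ ∣ s ∣) (∣pair∣ u≢v) (p⊆q⇒∣p∣≤∣q∣ (pair-⊆ u∈s v∈s))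

2≤∣∣⁻ : ∀ {n} (s : Subset n) → 2 ≤ ∣ s ∣ → ∃₂ λ u v → u ∈ˢ s × v ∈ˢ s × u ≢ v
2≤∣∣⁻ s 2≤s with elements s in eq | length-elements s | elements-unique s
... | []        | e | _             = contradiction (subst (2 ≤_) (sym e) 2≤s) λ ()
... | _ ∷ []    | e | _             = contradiction (subst (2 ≤_) (sym e) 2≤s) λ { (s≤s ()) }
... | u ∷ v ∷ _ | _ | (u≢v ∷ _) ∷ _ = u , v , ∈-elements⁻ (subst (u ∈_) (sym eq) (here refl))
                                      , ∈-elements⁻ (subst (v ∈_) (sym eq) (there (here refl))) , u≢v

-- `elements` sends the sets in `es` to distinct entries of the list of cliques.
length≤cliqueCount : ∀ {n} (a : Adjacency (Fin n)) r {es} → Unique es → All (λ e → ∣ e ∣ ≡ r) es →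
  (∀ {e} → e ∈ es → ∀ {u v} → u ∈ˢ e → v ∈ˢ e → u ≢ v → T (a u v)) →
  length es ≤ cliqueCount a r (allFin n)
length≤cliqueCount {n} a r {es} unique uniform adjacent = begin
  length es                        ≡⟨ length-map elements es ⟨
  length (map elements es)         ≤⟨ unique-⊆⇒length≤ (Unique.map⁺ elements-injective unique) clique ⟩
  length (cliques a r (allFin n))  ≡⟨ length-cliques a r (allFin n) ⟩
  cliqueCount a r (allFin n)       ∎
  where
  open ≤-Reasoning
  clique : ∀ {us} → us ∈ map elements es → us ∈ cliques a r (allFin n)
  clique i with e , e∈es , refl ← ∈-map⁻ elements i =
    subst (λ s → elements e ∈ cliques a s (allFin n)) (trans (length-elements e) (All.lookup uniform e∈es))
      (∈-cliques⁺ a (elements-⊆-allFin e) (unique⇒allPairs (elements-unique e)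
        (λ u∈ v∈ → adjacent e∈es (∈-elements⁻ u∈) (∈-elements⁻ v∈))))

-- Every listed clique is increasing, hence of the form `elements e`. Symmetry of `a` supplies the
-- adjacencies from later to earlier vertices.
cliqueCount≤length : ∀ {n} (a : Adjacency (Fin n)) → (∀ x y → a x y ≡ a y x) → ∀ r {es} →
  (∀ e → ∣ e ∣ ≡ r → (∀ {u v} → u ∈ˢ e → v ∈ˢ e → u ≢ v → T (a u v)) → e ∈ es) →
  cliqueCount a r (allFin n) ≤ length es
cliqueCount≤length {n} a a-sym r {es} contains = begin
  cliqueCount a r (allFin n)       ≡⟨ length-cliques a r (allFin n) ⟨
  length (cliques a r (allFin n))  ≤⟨ unique-⊆⇒length≤ (cliques-unique a r (Unique.allFin⁺ n)) edge∈ ⟩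
  length (map elements es)         ≡⟨ length-map elements es ⟩
  length es                        ∎
  where
  open ≤-Reasoning
  edge∈ : ∀ {us} → us ∈ cliques a r (allFin n) → us ∈ map elements es
  edge∈ i with us⊆ , clique , refl ← ∈-cliques⁻ a r (allFin n) i
          with e , refl ← elements-surjective us⊆ =
    ∈-map⁺ elements (contains e (sym (length-elements e)) adjacent)
    where
    adjacent : ∀ {u v} → u ∈ˢ e → v ∈ˢ e → u ≢ v → T (a u v)
    adjacent {u} {v} u∈e v∈e u≢v with ∈-AllPairs₂ clique (∈-elements⁺ u∈e) (∈-elements⁺ v∈e)
    ... | inj₁ u≡v        = contradiction u≡v u≢v
    ... | inj₂ (inj₁ uv) = uv
    ... | inj₂ (inj₂ vu) = subst T (a-sym v u) vu

-- From hypergraphs to two-coloured graphs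

_≟ˢ_ : ∀ {n} → DecidableEquality (Subset n)
_≟ˢ_ = ≡-dec Bool._≟_

module RedBlue {n r : ℕ} (H : Hypergraph n r) where

  open Matching {E = Subset n} (_≟ˢ_ {n})
  open DecMembership (_≟ˢ_ {n}) using (_∈?_)

  isPair? : ∀ (e p : Subset n) → Dec (∣ p ∣ ≡ 2 × p ⊆ˢ e)
  isPair? e p = (∣ p ∣ ≟ 2) ×-dec (p ⊆ˢ? e)

  shadow : Subset n → List (Subset n)
  shadow e = filter (isPair? e) (subsets n)

  ∈-shadow⁺ : ∀ {e u v} → u ∈ˢ e → v ∈ˢ e → u ≢ v → pair u v ∈ shadow e
  ∈-shadow⁺ {e} u∈e v∈e u≢v = ∈-filter⁺ (isPair? e) (∈-subsets _) (∣pair∣ u≢v , pair-⊆ u∈e v∈e)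

  ∈-shadow⁻ : ∀ {e p} → p ∈ shadow e → ∣ p ∣ ≡ 2 × p ⊆ˢ e
  ∈-shadow⁻ {e} p∈ = proj₂ (∈-filter⁻ (isPair? e) {xs = subsets n} p∈)

  -- Left vertices are hyperedges and right vertices are the pairs inside them; `R` gives the red
  -- edges and `B` the blue ones.
  open König (minimumCover shadow (edges H)) public

  graph : List (Subset n × Subset n) → Adjacency (Fin n)
  graph M u v = does (pair u v ∈? map proj₂ M)

  graph⁺ : ∀ M {u v} → pair u v ∈ map proj₂ M → T (graph M u v)
  graph⁺ M {u} {v} i with pair u v ∈? map proj₂ M
  ... | yes _ = _
  ... | no ¬i = ¬i i

  graph⁻ : ∀ M {u v} → T (graph M u v) → pair u v ∈ map proj₂ M
  graph⁻ M {u} {v} t with pair u v ∈? map proj₂ M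
  ... | yes i = i

  graph-sym : ∀ M u v → graph M u v ≡ graph M v u
  graph-sym M u v = cong (λ p → does (p ∈? map proj₂ M)) (∪-comm ⁅ u ⁆ ⁅ v ⁆)

  red blue : Adjacency (Fin n)
  red  = graph R
  blue = graph B

  blue-red-disjoint : ∀ u v → T (blue u v) → ¬ T (red u v)
  blue-red-disjoint u v b r = disjoint (graph⁻ R r) (graph⁻ B b)

  -- Hyperedges matched by `B` are counted by their distinct blue pairs. In every other hyperedge
  -- all pairs are red by `covered`, so it is a red r-clique.
  size≤ : size H ≤ cliqueCount blue 2 (allFin n) + cliqueCount red r (allFin n)
  size≤ = begin
    length (edges H)                                     ≡⟨ ↭-length split ⟩
    length ((free ++ map proj₁ R) ++ map proj₁ B)        ≡⟨ length-++ (free ++ map proj₁ R) ⟩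
    length (free ++ map proj₁ R) + length (map proj₁ B)  ≡⟨ +-comm (length (free ++ map proj₁ R)) _ ⟩
    length (map proj₁ B) + length (free ++ map proj₁ R)
      ≡⟨ cong (_+ length (free ++ map proj₁ R)) (trans (length-map proj₁ B) (sym (length-map proj₂ B))) ⟩
    length (map proj₂ B) + length (free ++ map proj₁ R)  ≤⟨ +-mono-≤ blue-bound red-bound ⟩
    cliqueCount blue 2 (allFin n) + cliqueCount red r (allFin n) ∎
    where
    open ≤-Reasoning
    ∣p∣≡2 : All (λ p → ∣ p ∣ ≡ 2) (map proj₂ B)
    ∣p∣≡2 = All-map⁺ (All.map (proj₁ ∘ ∈-shadow⁻) incidentB)
    blue-bound : length (map proj₂ B) ≤ cliqueCount blue 2 (allFin n)
    blue-bound = length≤cliqueCount blue 2 uniqueB ∣p∣≡2 λ p∈ u∈p v∈p u≢v →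
      graph⁺ B (subst (_∈ map proj₂ B) (sym (pair≡ (All.lookup ∣p∣≡2 p∈) u∈p v∈p u≢v)) p∈)
    red-bound : length (free ++ map proj₁ R) ≤ cliqueCount red r (allFin n)
    red-bound = length≤cliqueCount red r
      (AllPairs-++⁻ˡ (Unique-resp-↭ (setoid _) (↭⇒↭ₛ split) (unique H)))
      (++⁻ˡ _ (All-resp-↭ split (uniform H)))
      λ e∈ u∈e v∈e u≢v → graph⁺ R (covered e∈ (∈-shadow⁺ u∈e v∈e u≢v))

  -- The whole matching: it assigns to each edge of the union a hyperedge containing it, and no
  -- hyperedge is used twice.
  M : List (Subset n × Subset n)
  M = R ++ B

  M-unique : Unique (map proj₁ M)
  M-unique = subst Unique (sym (map-++ proj₁ R B)) (AllPairs-++⁻ʳ free (subst Unique (++-assoc free _ _)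
    (Unique-resp-↭ (setoid _) (↭⇒↭ₛ split) (unique H))))

  M-edge : ∀ {h p} → (h , p) ∈ M → h ∈ edges H
  M-edge {h} i = ∈-resp-↭ (↭-sym split) (subst (h ∈_) (sym (++-assoc free _ _))
    (∈-++⁺ʳ free (subst (h ∈_) (map-++ proj₁ R B) (∈-map⁺ proj₁ i))))

  M-incident : ∀ {h p} → (h , p) ∈ M → p ⊆ˢ h
  M-incident i = proj₂ (∈-shadow⁻ (All.lookup (All-++⁺ incidentR incidentB) i))

  union⇒M : ∀ {u v} → T (blue u v ∨ red u v) → ∃ λ h → (h , pair u v) ∈ M
  union⇒M {u} {v} t with ∈-map⁻ proj₂ (subst (pair u v ∈_) (sym (map-++ proj₂ R B)) (either (Equivalence.to T-∨ t)))
    where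
    either : T (blue u v) ⊎ T (red u v) → pair u v ∈ map proj₂ R ++ map proj₂ B
    either (inj₁ b) = ∈-++⁺ʳ _ (graph⁻ B b)
    either (inj₂ r) = ∈-++⁺ˡ (graph⁻ R r)
  ... | (h , _) , i , refl = h , i

  -- The vertices of a k-clique in the union form the core of a Berge copy of K_k, and `M` provides
  -- the distinct hyperedges for its edges.
  union-free : ∀ k → BergeFree (K k) H → cliqueCount (λ u v → blue u v ∨ red u v) k (allFin n) ≡ 0
  union-free k free with cliqueCount union k (allFin n) ≟ 0
    where
    union : Adjacency (Fin n)
    union u v = blue u v ∨ red u v
  ... | yes none = none
  ... | no some with us , us⊆ , clique , refl ← clique-exists _ k (allFin n) some = contradiction copy free
    where
    k′ = length us
    us-unique : Unique us
    us-unique = AllPairs-resp-⊆ us⊆ (Unique.allFin⁺ n)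
    φ : Fin k′ → Fin n
    φ = lookup us

    adjacent : ∀ {i j} → i ≢ j → ∃ λ h → (h , pair (φ i) (φ j)) ∈ M
    adjacent {i} {j} i≢j with ∈-AllPairs₂ clique (∈-lookup i) (∈-lookup j)
    ... | inj₁ eq        = contradiction (lookup-injective us-unique eq) i≢j
    ... | inj₂ (inj₁ t) = union⇒M t
    ... | inj₂ (inj₂ t) with h , p ← union⇒M t = h , subst (λ q → (h , q) ∈ M) (∪-comm ⁅ φ j ⁆ ⁅ φ i ⁆) p

    -- The equivalence says that `p` is exactly the image of `e` on the core, so `e` can be
    -- recovered from `p`; injectivity of `f` relies on this.
    hyperedge : ∀ e → ∣ e ∣ ≡ 2 → ∃₂ λ h p → (h , p) ∈ M × (∀ w → (w ∈ˢ e → φ w ∈ˢ p) × (φ w ∈ˢ p → w ∈ˢ e))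
    hyperedge e ∣e∣≡2
      with u , v , u∈e , v∈e , u≢v ← 2≤∣∣⁻ e (≤-reflexive (sym ∣e∣≡2))
      with h , i ← adjacent u≢v
      = h , pair (φ u) (φ v) , i , λ w →
        (λ w∈e → [ (λ { refl → ∈-pairˡ (φ u) (φ v) }) , (λ { refl → ∈-pairʳ (φ u) (φ v) }) ]′
          (∈-pair⁻ (subst (w ∈ˢ_) (sym (pair≡ ∣e∣≡2 u∈e v∈e u≢v)) w∈e))) ,
        (λ φw∈ → [ (λ eq → subst (_∈ˢ e) (sym (lookup-injective us-unique eq)) u∈e)
                 , (λ eq → subst (_∈ˢ e) (sym (lookup-injective us-unique eq)) v∈e) ]′ (∈-pair⁻ φw∈))

    image : ∀ i → _
    image i = hyperedge (edge (K k′) i) (All.lookup (uniform (K k′)) (∈-lookup i))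

    f : Fin (size (K k′)) → Fin (size H)
    f i = let _ , _ , hp∈ , _ = image i in Any.index (M-edge hp∈)

    edge-f : ∀ i → proj₁ (image i) ≡ edge H (f i)
    edge-f i = let _ , _ , hp∈ , _ = image i in lookup-index (M-edge hp∈)

    copy : BergeCopy (K k′) H
    copy = record
      { φ           = φ
      ; φ-injective = lookup-injective us-unique
      ; f           = f
      ; f-injective = λ {i} {j} fi≡fj →
          let hᵢ , pᵢ , i∈ , ⇔ᵢ = image i
              hⱼ , pⱼ , j∈ , ⇔ⱼ = image j
              h≡ = trans (edge-f i) (trans (cong (edge H) fi≡fj) (sym (edge-f j)))
              -- A hyperedge is matched to only one pair, so equal hyperedges force equal images.
              p≡ = unique-map⇒functional M-unique (subst (λ h → (h , pᵢ) ∈ M) h≡ i∈) j∈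
          in lookup-injective (unique (K k′)) (⊆-antisym
               (λ {w} w∈ → proj₂ (⇔ⱼ w) (subst (φ w ∈ˢ_) p≡ (proj₁ (⇔ᵢ w) w∈)))
               (λ {w} w∈ → proj₂ (⇔ᵢ w) (subst (φ w ∈ˢ_) (sym p≡) (proj₁ (⇔ⱼ w) w∈))))
      ; contains    = λ i u u∈ →
          let h , p , i∈ , ⇔ᵢ = image i
          in subst (φ u ∈ˢ_) (edge-f i) (M-incident i∈ (proj₁ (⇔ᵢ u) u∈))
      }

-- Turán hypergraphs and the extremal theorem

⌈m/n⌉≤1+m/n : ∀ m n .{{_ : NonZero n}} → ⌈ m / n ⌉ ≤ suc (m / n)
⌈m/n⌉≤1+m/n m n = begin
  (m + (n ∸ 1)) / n  ≤⟨ /-monoˡ-≤ n (+-monoʳ-≤ m (m∸n≤m n 1)) ⟩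
  (m + n) / n        ≡⟨ +-distrib-/-∣ʳ m ∣-refl ⟩
  m / n + n / n      ≡⟨ cong (m / n +_) (n/n≡1 n) ⟩
  m / n + 1          ≡⟨ +-comm (m / n) 1 ⟩
  suc (m / n)        ∎
  where open ≤-Reasoning

module _ {n m : ℕ} (π : Fin n → Fin m) where

  open Multipartite π

  ∈-part⁺ : ∀ {u j} → π u ≡ j → u ∈ˢ part π j
  ∈-part⁺ {u} refl = lookup⇒[]= u _ (trans (lookup∘tabulate _ u) (dec-true (π u Fin.≟ π u) refl))

  ∈-part⁻ : ∀ {u j} → u ∈ˢ part π j → π u ≡ j
  ∈-part⁻ {u} {j} i with π u Fin.≟ j | trans (sym (lookup∘tabulate (λ v → does (π v Fin.≟ j)) u)) ([]=⇒lookup i)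
  ... | yes p | _ = p

  transversal⁺ : ∀ {e} → (∀ {u v} → u ∈ˢ e → v ∈ˢ e → u ≢ v → π u ≢ π v) → Transversal π e
  transversal⁺ {e} apart j = ≮⇒≥ λ 1<∣e∩part∣ →
    let u , v , u∈ , v∈ , u≢v = 2≤∣∣⁻ (e ∩ part π j) 1<∣e∩part∣
        u∈e , u∈j = x∈p∩q⁻ e _ u∈
        v∈e , v∈j = x∈p∩q⁻ e _ v∈
    in apart u∈e v∈e u≢v (trans (∈-part⁻ u∈j) (sym (∈-part⁻ v∈j)))

  transversal⁻ : ∀ {e} → Transversal π e → ∀ {u v} → u ∈ˢ e → v ∈ˢ e → u ≢ v → π u ≢ π v
  transversal⁻ t {u} {v} u∈e v∈e u≢v πu≡πv = <⇒≱ (2≤∣∣⁺ (x∈p∩q⁺ (u∈e , ∈-part⁺ πu≡πv)) (x∈p∩q⁺ (v∈e , ∈-part⁺ refl)) u≢v) (t (π v))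

  partSize-tabulate : ∀ j {l} (g : Fin l → Fin n) →
    partSize j (tabulate g) ≡ ∣ Vec.tabulate (λ i → does (π (g i) Fin.≟ j)) ∣
  partSize-tabulate j {zero}  g = refl
  partSize-tabulate j {suc l} g with does (π (g zero) Fin.≟ j)
  ... | true  = cong suc (partSize-tabulate j (g ∘ suc))
  ... | false = partSize-tabulate j (g ∘ suc)

balanced⇒balancedList : ∀ {n m} (π : Fin n → Fin (suc m)) → Balanced π →
  Multipartite.BalancedList π (n / suc m) (allFin n)
balanced⇒balancedList {n} {m} π bal j rewrite partSize-tabulate π j {n} id with bal j
... | inj₁ eq = ≤-reflexive (sym eq) , ≤-trans (≤-reflexive eq) (n≤1+n _)
... | inj₂ eq = subst (n / suc m ≤_) (sym eq) (/-monoˡ-≤ (suc m) (m≤m+n n m))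
              , subst (_≤ suc (n / suc m)) (sym eq) (⌈m/n⌉≤1+m/n n (suc m))

-- By pigeonhole two of the `suc m` core vertices share a part, but the hyperedge assigned to their
-- edge would have to contain both.
turán-bergeFree : ∀ {n r m} {T : Hypergraph n r} → IsTurán m T → BergeFree (K (suc m)) T
turán-bergeFree {n} {m = m} {T} (π , _ , edges⇔) copy
  with i , j , i<j , πφi≡πφj ← Fin.pigeonhole ≤-refl (π ∘ BergeCopy.φ copy) =
  transversal⁻ π (proj₂ (Equivalence.to (edges⇔ _) (∈-lookup (f e))))
    (contains e i (subst (i ∈ˢ_) e≡ (∈-pairˡ i j))) (contains e j (subst (j ∈ˢ_) e≡ (∈-pairʳ i j)))
    (i≢j ∘ φ-injective) πφi≡πφj
  where
  open BergeCopy copy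
  i≢j : i ≢ j
  i≢j = Fin.<⇒≢ i<j
  pair∈ : pair i j ∈ edges (K (suc m))
  pair∈ = ∈-filter⁺ (λ e → ∣ e ∣ ≟ 2) (∈-subsets (pair i j)) (∣pair∣ i≢j)
  e = Any.index pair∈
  e≡ : pair i j ≡ edge (K (suc m)) e
  e≡ = lookup-index pair∈

turán-maximum : ∀ {n r m} → 4 + r ≤ m → {T : Hypergraph n (2 + r)} → IsTurán m T →
  (H : Hypergraph n (2 + r)) → BergeFree (K (suc m)) H → size H ≤ size T
turán-maximum {n} {r} {m@(suc _)} r≤m {T} (π , balanced , edges⇔) H free
  with n / m | balanced⇒balancedList π balanced
-- Every part has at most one vertex, so every set of the right size is transversal and `T` contains
-- all hyperedges of `H`.
... | zero | bal = unique-⊆⇒length≤ (unique H) λ {e} e∈ → Equivalence.from (edges⇔ e)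
  (All.lookup (uniform H) e∈ , λ j → ≤-trans (∣p∩q∣≤∣q∣ e (part π j))
    (subst (_≤ 1) (partSize-tabulate π j {n} id) (proj₂ (bal j))))
-- All parts are nonempty, as `coloured-zykov` requires for removing a full transversal.
... | suc q | bal = begin
  size H
    ≤⟨ size≤ ⟩
  cliqueCount blue 2 (allFin n) + cliqueCount red (2 + r) (allFin n)
    ≤⟨ coloured-zykov (graph-sym B) (graph-sym R) blue-red-disjoint q
         {allFin n} {allFin n} (union-free (suc m) free) refl bal r r≤m ⟩
  cliqueCount distinctParts (2 + r) (allFin n)
    ≤⟨ cliqueCount≤length distinctParts distinctParts-sym (2 + r) (λ e ∣e∣≡r adjacent →
         Equivalence.from (edges⇔ e) (∣e∣≡r , transversal⁺ π λ u∈e v∈e u≢v → distinctParts⁻ (adjacent u∈e v∈e u≢v))) ⟩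
  size T ∎
  where
  open ≤-Reasoning
  open Multipartite π
  open RedBlue H hiding (free)

corollary22 : ∀ (r k : ℕ) → 2 ≤ r → r + 2 < k →
    ∀ (n : ℕ) → 1 ≤ n →
    ∀ (T : Hypergraph n r) → IsTurán (k ∸ 1) T →
    IsMaximumBergeFree (K k) T
corollary22 (suc (suc r)) (suc m) (s≤s (s≤s z≤n)) (s≤s r+2≤m) n _ T turán =
  turán-bergeFree {T = T} turán ,
  -- With uniformity `2 + r` and `k = suc m`, the hypothesis becomes `4 + r ≤ m`.
  turán-maximum (≤-trans (≤-reflexive (+-comm 2 (2 + r))) r+2≤m) {T} turán
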